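{- Let $K$ be an algebraically closed field, let $G$ be an algebraic group over $K$, and let $\Gamma \leq G(K)$ be a subgroup. If $\Gamma$ is of Lang type, then $\Gamma$ is uniformly of Lang type.
   Context: Let $K$ be an algebraically closed field, $G$ an algebraic group over $K$, and $\Gamma \leq G(K)$ a subgroup. For $n \geq 1$, $G^n$ denotes the $n$-th Cartesian power of $G$, and $\Gamma^n \leq G^n(K)$ is the corresponding power of $\Gamma$. Subvarieties of $G^n$ are Zariski closed, not necessarily irreducible, and defined over $K$. The group operation is written additively, so $\gamma + H$ denotes the (left) translate of $H$ by $\gamma$; this is only notation and $G$ is not assumed to be commutative. $\Gamma$ is of *Lang type* if for every $n \geq 1$ and every subvariety $X$ of $G^n$, the set $X(K) \cap \Gamma^n$ is a finite (possibly empty) union of cosets of subgroups of $\Gamma^n$. An *algebraic family* $\{X_b\}_{b \in B}$ of subvarieties of $G^n$ is given by an algebraic variety $B$ over $K$ and a closed subvariety $X \subseteq G^n \times B$; for $b \in B(K)$, $X_b \subseteq G^n$ is the fibre of $X$ over $b$. $\Gamma$ is *uniformly of Lang type* if it is of Lang type and in addition: for every $n \geq 1$ and every algebraic family $\{X_b\}_{b \in B}$ of subvarieties of $G^n$ there is a finite sequence $H_1, \ldots, H_m$ of algebraic subgroups of $G^n$ (depending only on the family; repetitions in the sequence are allowed) such that for every $b \in B(K)$ there are a set $I \subseteq \{1, \ldots, m\}$ and points $\gamma_1, \ldots, \gamma_m \in \Gamma^n$ such that the Zariski closure of $X_b(K) \cap \Gamma^n$ in $G^n$ is $\bigcup_{i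 \in I} (\gamma_i + H_i)$ (the empty set if $I = \emptyset$). -}

module Defs where

open import Algebra.Apartness.Bundles using (HeytingField; HeytingCommutativeRing)
open import Algebra.Bundles using (CommutativeRing; Group)
import Algebra.Construct.DirectProduct as DirectProduct
import Algebra.Construct.Terminal as Terminal
import Algebra.Properties.Semiring.Exp as Exp
import Algebra.Properties.Semiring.Sum as Sum
open import Data.Fin.Base using (Fin; fromℕ; toℕ; splitAt; _↑ˡ_; _↑ʳ_)
open import Data.Fin.Properties using (splitAt⁻¹-↑ˡ; splitAt⁻¹-↑ʳ; splitAt-↑ˡ; splitAt-↑ʳ)
import Data.Fin.Subset as Subset
open import Data.List.Base using (List; []; _∷_; _++_; map; cartesianProduct)
import Data.List.Membership.Propositional as List
open import Data.List.Membership.Propositional.Properties using (∈-cartesianProduct⁺)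
open import Data.List.Relation.Unary.All as All using (All; []; _∷_)
import Data.List.Relation.Unary.All.Properties as All
open import Data.List.Relation.Unary.Any using (here)
open import Data.Nat.Base as ℕ using (ℕ; zero; suc)
open import Data.Product.Base using (Σ; Σ-syntax; ∃; ∃-syntax; _×_; _,_; proj₁; proj₂; uncurry)
open import Data.Product.Relation.Binary.Pointwise.NonDependent using (×-setoid)
open import Data.Sum.Base using (inj₁; inj₂)
open import Data.Unit.Polymorphic.Base using (⊤; tt)
open import Data.Vec.Functional as Vector using (Vector)
open import Function.Base using (id; _∘_)
open import Function.Bundles using (_⇔_)
open import Level using (Level) renaming (suc to lsuc)
open import Relation.Binary.Bundles using (Setoid)
open import Relation.Binary.Definitions using (_Respects_)
open import Relation.Binary.PropositionalEquality as ≡ using (_≡_)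
open import Relation.Unary using (Pred; _∈_; _⊆_; _∩_; _≐_; _⟨×⟩_; ⋃)

-- With excluded middle a Heyting field is the same thing as a field: x # y is
-- the negation of x ≈ y, by tightness.

module _ {ℓ : Level} (K : HeytingField ℓ ℓ ℓ) where

  open HeytingField K
  private
    ring = HeytingCommutativeRing.commutativeRing heytingCommutativeRing
  open Exp (CommutativeRing.semiring ring) using (_^_)
  open Sum (CommutativeRing.semiring ring) using (sum)

  -- c₀ + c₁ x + ⋯ + c_{d+1} x^{d+1} has a root as soon as c_{d+1} ≠ 0.
  IsAlgebraicallyClosed : Set ℓ
  IsAlgebraicallyClosed =
    ∀ d (c : Vector Carrier (suc (suc d))) → c (fromℕ (suc d)) # 0# →
    ∃[ x ] sum (λ i → c i * x ^ toℕ i) ≈ 0#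

-- Polynomials only matter through their values, so they are represented by
-- ring expressions rather than by normal forms.

module _ {ℓ : Level} (K : HeytingField ℓ ℓ ℓ) where

  open HeytingField K using (Carrier)

  infixl 6 _⊕_
  infixl 7 _⊗_

  data Poly (n : ℕ) : Set ℓ where
    con : Carrier → Poly n
    var : Fin n → Poly n
    _⊕_ : Poly n → Poly n → Poly n
    _⊗_ : Poly n → Poly n → Poly n

module _ {ℓ : Level} {K : HeytingField ℓ ℓ ℓ} where

  open HeytingField K

  eval : ∀ {n} → Poly K n → Vector Carrier n → Carrier
  eval (con a) x = a
  eval (var i) x = x i
  eval (p ⊕ q) x = eval p x + eval q x
  eval (p ⊗ q) x = eval p x * eval q x

  Zeros : ∀ {n} → List (Poly K n) → Pred (Vector Carrier n) ℓ
  Zeros ps x = All (λ p → eval p x ≈ 0#) ps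

  rename : ∀ {m n} → (Fin m → Fin n) → Poly K m → Poly K n
  rename ρ (con a) = con a
  rename ρ (var i) = var (ρ i)
  rename ρ (p ⊕ q) = rename ρ p ⊕ rename ρ q
  rename ρ (p ⊗ q) = rename ρ p ⊗ rename ρ q

  eval-rename : ∀ {m n} (ρ : Fin m → Fin n) p x → eval (rename ρ p) x ≡ eval p (x ∘ ρ)
  eval-rename ρ (con a) x = ≡.refl
  eval-rename ρ (var i) x = ≡.refl
  eval-rename ρ (p ⊕ q) x = ≡.cong₂ _+_ (eval-rename ρ p x) (eval-rename ρ q x)
  eval-rename ρ (p ⊗ q) x = ≡.cong₂ _*_ (eval-rename ρ p x) (eval-rename ρ q x)

  eval-cong : ∀ {n} (p : Poly K n) {x y} → (∀ i → x i ≈ y i) → eval p x ≈ eval p y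
  eval-cong (con a) x≈y = refl
  eval-cong (var i) x≈y = x≈y i
  eval-cong (p ⊕ q) x≈y = +-cong (eval-cong p x≈y) (eval-cong q x≈y)
  eval-cong (p ⊗ q) x≈y = *-cong (eval-cong p x≈y) (eval-cong q x≈y)

  zeros-rename⁺ : ∀ {m n} (ps : List (Poly K m)) (ρ : Fin m → Fin n) {x y} →
                  (∀ i → y (ρ i) ≡ x i) → x ∈ Zeros ps → y ∈ Zeros (map (rename ρ) ps)
  zeros-rename⁺ []       ρ     y∘ρ≡x []          = []
  zeros-rename⁺ (p ∷ ps) ρ {y = y} y∘ρ≡x (px≈0 ∷ x∈) =
    trans (reflexive (eval-rename ρ p y))
      (trans (eval-cong p (λ i → reflexive (y∘ρ≡x i))) px≈0)
    ∷ zeros-rename⁺ ps ρ y∘ρ≡x x∈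

  zeros-rename⁻ : ∀ {m n} (ps : List (Poly K m)) (ρ : Fin m → Fin n) {x} →
                  x ∈ Zeros (map (rename ρ) ps) → x ∘ ρ ∈ Zeros ps
  zeros-rename⁻ []       ρ []          = []
  zeros-rename⁻ (p ∷ ps) ρ (px≈0 ∷ x∈) =
    trans (sym (reflexive (eval-rename ρ p _))) px≈0 ∷ zeros-rename⁻ ps ρ x∈

-- As the field is algebraically closed, a variety is given by its set of
-- rational points, covered by finitely many affine charts. Each chart is a
-- parametrisation of a set of points by an affine algebraic set.

module _ {ℓ : Level} (K : HeytingField ℓ ℓ ℓ) where

  private
    module K = HeytingField K

  record Atlas (S : Setoid ℓ ℓ) : Set (lsuc ℓ) where
    open Setoid S
    field
      Chart     : Set
      charts    : List Chart
      ∈-charts  : ∀ c → c List.∈ charts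
      dim       : Chart → ℕ
      equations : ∀ c → List (Poly K (dim c))

    Coords : Chart → Set ℓ
    Coords c = Σ[ x ∈ Vector K.Carrier (dim c) ] x ∈ Zeros (equations c)

    field
      point            : ∀ c → Coords c → Carrier
      point-cong       : ∀ c {u v} → (∀ i → proj₁ u i K.≈ proj₁ v i) → point c u ≈ point c v
      point-injective  : ∀ c {u v} → point c u ≈ point c v → ∀ i → proj₁ u i K.≈ proj₁ v i
      point-surjective : ∀ p → ∃[ c ] ∃[ u ] point c u ≈ p

module _ {ℓ : Level} {K : HeytingField ℓ ℓ ℓ} where

  private
    module K = HeytingField K

  -- Zariski closed: in every chart, cut out by finitely many polynomials.
  record IsClosed {S} (A : Atlas K S) (Z : Pred (Setoid.Carrier S) ℓ) : Set ℓ where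
    open Setoid S
    open Atlas A
    field
      respects : Z Respects _≈_
      locally  : ∀ c → Σ[ ps ∈ List (Poly K (dim c)) ]
                   (∀ u → point c u ∈ Z ⇔ proj₁ u ∈ Zeros ps)

  closure : ∀ {S} → Atlas K S → Pred (Setoid.Carrier S) ℓ → Pred (Setoid.Carrier S) (lsuc ℓ)
  closure A P p = ∀ Z → IsClosed A Z → P ⊆ Z → p ∈ Z

  -- f is a morphism: around each point u which f sends into a chart d, there
  -- is a basic open set { g ≠ 0 } of the chart of u that f sends into d and
  -- on which the coordinates of f are the quotients hₖ / g. This includes
  -- the continuity of f.
  IsRegular : ∀ {S T} → Atlas K S → Atlas K T → (Setoid.Carrier S → Setoid.Carrier T) → Set ℓ
  IsRegular {T = T} A B f =
    ∀ c d (u : A.Coords c) (v : B.Coords d) → f (A.point c u) ≈ B.point d v →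
    Σ[ g ∈ Poly K (A.dim c) ] Σ[ h ∈ Vector (Poly K (A.dim c)) (B.dim d) ]
      eval g (proj₁ u) K.# K.0# ×
      (∀ (x : A.Coords c) → eval g (proj₁ x) K.# K.0# →
        Σ[ y ∈ B.Coords d ] f (A.point c x) ≈ B.point d y ×
          (∀ k → eval g (proj₁ x) K.* proj₁ y k K.≈ eval (h k) (proj₁ x)))
    where
    module A = Atlas A
    module B = Atlas B
    open Setoid T using (_≈_)

  -- The charts of the product are the products of charts; the topology is
  -- the Zariski topology and not the product topology.
  infixr 2 _×ᵃ_
  _×ᵃ_ : ∀ {S T} → Atlas K S → Atlas K T → Atlas K (×-setoid S T)
  _×ᵃ_ {S} {T} A B = record
    { Chart            = A.Chart × B.Chart
    ; charts           = cartesianProduct A.charts B.charts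
    ; ∈-charts         = λ (c , d) → ∈-cartesianProduct⁺ (A.∈-charts c) (B.∈-charts d)
    ; dim              = λ (c , d) → A.dim c ℕ.+ B.dim d
    ; equations        = λ (c , d) → map (rename (_↑ˡ B.dim d)) (A.equations c)
                                  ++ map (rename (A.dim c ↑ʳ_)) (B.equations d)
    ; point            = λ (c , d) u → A.point c (left c d u) , B.point d (right c d u)
    ; point-cong       = λ (c , d) u≈v → A.point-cong c (λ i → u≈v (i ↑ˡ B.dim d))
                                       , B.point-cong d (λ j → u≈v (A.dim c ↑ʳ j))
    ; point-injective  = λ (c , d) (p≈q , p′≈q′) →
                           join (A.point-injective c p≈q) (B.point-injective d p′≈q′)
    ; point-surjective = λ (p , q) →
        let c , u , u↦p = A.point-surjective p
            d , v , v↦q = B.point-surjective q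
        in  (c , d) , pair c d u v
          , S.trans (A.point-cong c (λ i → K.reflexive (++-↑ˡ c d u v i))) u↦p
          , T.trans (B.point-cong d (λ j → K.reflexive (++-↑ʳ c d u v j))) v↦q
    }
    where
    module S = Setoid S
    module T = Setoid T
    module A = Atlas A
    module B = Atlas B

    left : ∀ c d → Σ (Vector K.Carrier (A.dim c ℕ.+ B.dim d)) _ → A.Coords c
    left c d (x , x∈) = x ∘ (_↑ˡ B.dim d) , zeros-rename⁻ (A.equations c) (_↑ˡ B.dim d) (All.++⁻ˡ _ x∈)

    right : ∀ c d → Σ (Vector K.Carrier (A.dim c ℕ.+ B.dim d)) _ → B.Coords d
    right c d (x , x∈) =
      x ∘ (A.dim c ↑ʳ_) , zeros-rename⁻ (B.equations d) (A.dim c ↑ʳ_)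
                            (All.++⁻ʳ (map (rename (_↑ˡ B.dim d)) (A.equations c)) x∈)

    join : ∀ {m n} {x y : Vector K.Carrier (m ℕ.+ n)} →
           (∀ i → x (i ↑ˡ n) K.≈ y (i ↑ˡ n)) → (∀ j → x (m ↑ʳ j) K.≈ y (m ↑ʳ j)) →
           ∀ k → x k K.≈ y k
    join {m} {n} {x} {y} l r k with splitAt m k in eq
    ... | inj₁ i = ≡.subst (λ k → x k K.≈ y k) (splitAt⁻¹-↑ˡ eq) (l i)
    ... | inj₂ j = ≡.subst (λ k → x k K.≈ y k) (splitAt⁻¹-↑ʳ {m} eq) (r j)

    ++-↑ˡ : ∀ c d (u : A.Coords c) (v : B.Coords d) i →
            (proj₁ u Vector.++ proj₁ v) (i ↑ˡ B.dim d) ≡ proj₁ u i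
    ++-↑ˡ c d u v i rewrite splitAt-↑ˡ (A.dim c) i (B.dim d) = ≡.refl

    ++-↑ʳ : ∀ c d (u : A.Coords c) (v : B.Coords d) j →
            (proj₁ u Vector.++ proj₁ v) (A.dim c ↑ʳ j) ≡ proj₁ v j
    ++-↑ʳ c d u v j rewrite splitAt-↑ʳ (A.dim c) (B.dim d) j = ≡.refl

    pair : ∀ c d (u : A.Coords c) (v : B.Coords d) →
           Σ[ x ∈ Vector K.Carrier (A.dim c ℕ.+ B.dim d) ]
             x ∈ Zeros (map (rename (_↑ˡ B.dim d)) (A.equations c)
                     ++ map (rename (A.dim c ↑ʳ_)) (B.equations d))
    pair c d u v = proj₁ u Vector.++ proj₁ v
                 , All.++⁺ (zeros-rename⁺ (A.equations c) (_↑ˡ B.dim d) (++-↑ˡ c d u v) (proj₂ u))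
                           (zeros-rename⁺ (B.equations d) (A.dim c ↑ʳ_) (++-↑ʳ c d u v) (proj₂ v))

  -- Regularity of the identity with respect to A twice says that the overlap
  -- of two charts is open in each and that the transition maps are regular.
  record IsVariety {S} (A : Atlas K S) : Set ℓ where
    field
      compatible : IsRegular A A id
      separated  : IsClosed (A ×ᵃ A) (uncurry (Setoid._≈_ S))

record Variety {ℓ} (K : HeytingField ℓ ℓ ℓ) : Set (lsuc ℓ) where
  field
    points    : Setoid ℓ ℓ
    atlas     : Atlas K points
    isVariety : IsVariety atlas

  open Setoid points public using () renaming (Carrier to Point)

module _ {ℓ : Level} (G : Group ℓ ℓ) where

  open Group G

  record IsSubgroup (H : Pred Carrier ℓ) : Set ℓ where
    field
      respects  : H Respects _≈_
      ε-closed  : ε ∈ H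
      ∙-closed  : ∀ {x y} → x ∈ H → y ∈ H → x ∙ y ∈ H
      ⁻¹-closed : ∀ {x} → x ∈ H → x ⁻¹ ∈ H

  translate : Carrier → Pred Carrier ℓ → Pred Carrier ℓ
  translate γ H x = ∃[ h ] h ∈ H × x ≈ γ ∙ h

-- Powers are iterated products ending with a one-point factor, so that G¹
-- is G × 1.

infixl 8 _^ᵍ_
_^ᵍ_ : ∀ {ℓ} → Group ℓ ℓ → ℕ → Group ℓ ℓ
G ^ᵍ zero  = Terminal.group
G ^ᵍ suc n = DirectProduct.group G (G ^ᵍ n)

module _ {ℓ : Level} (G : Group ℓ ℓ) where

  power : Pred (Group.Carrier G) ℓ → ∀ n → Pred (Group.Carrier (G ^ᵍ n)) ℓ
  power Γ zero    = λ _ → ⊤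
  power Γ (suc n) = Γ ⟨×⟩ power Γ n

record AlgebraicGroup {ℓ} (K : HeytingField ℓ ℓ ℓ) : Set (lsuc ℓ) where
  field
    group : Group ℓ ℓ

  open Group group public

  field
    atlas      : Atlas K setoid
    isVariety  : IsVariety atlas
    ∙-regular  : IsRegular (atlas ×ᵃ atlas) atlas (uncurry _∙_)
    ⁻¹-regular : IsRegular atlas atlas _⁻¹

module _ {ℓ : Level} {K : HeytingField ℓ ℓ ℓ} where

  onePoint : Atlas K (Group.setoid Terminal.group)
  onePoint = record
    { Chart            = ⊤
    ; charts           = tt ∷ []
    ; ∈-charts         = λ _ → here ≡.refl
    ; dim              = λ _ → 0
    ; equations        = λ _ → []
    ; point            = λ _ _ → _
    ; point-cong       = λ _ _ → _
    ; point-injective  = λ _ _ ()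
    ; point-surjective = λ _ → tt , (Vector.[] , []) , _
    }

  powerAtlas : (G : AlgebraicGroup K) (n : ℕ) →
               Atlas K (Group.setoid (AlgebraicGroup.group G ^ᵍ n))
  powerAtlas G zero    = onePoint
  powerAtlas G (suc n) = AlgebraicGroup.atlas G ×ᵃ powerAtlas G n

module _ {ℓ : Level} {K : HeytingField ℓ ℓ ℓ} (G : AlgebraicGroup K)
         (Γ : Pred (AlgebraicGroup.Carrier G) ℓ) where

  open AlgebraicGroup G using (group)

  IsOfLangType : Set (lsuc ℓ)
  IsOfLangType =
    ∀ n → 1 ℕ.≤ n →
    let module Gⁿ = Group (group ^ᵍ n)
        Γⁿ = power group Γ n
    in
    ∀ X → IsClosed (powerAtlas G n) X →
    ∃[ m ] Σ[ H ∈ (Fin m → Pred Gⁿ.Carrier ℓ) ] Σ[ γ ∈ (Fin m → Gⁿ.Carrier) ]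
      (∀ i → IsSubgroup (group ^ᵍ n) (H i) × H i ⊆ Γⁿ × γ i ∈ Γⁿ) ×
      (X ∩ Γⁿ) ≐ ⋃ (Fin m) (λ i → translate (group ^ᵍ n) (γ i) (H i))

  -- The family is X ⊆ Gⁿ × B, with fibres X_b = { x ∣ (x , b) ∈ X }.
  IsUniformlyOfLangType : Set (lsuc ℓ)
  IsUniformlyOfLangType = IsOfLangType ×
    (∀ n → 1 ℕ.≤ n →
    let module Gⁿ = Group (group ^ᵍ n)
        Γⁿ = power group Γ n
    in
    ∀ (B : Variety K) X → IsClosed (powerAtlas G n ×ᵃ Variety.atlas B) X →
    ∃[ m ] Σ[ H ∈ (Fin m → Pred Gⁿ.Carrier ℓ) ]
      (∀ i → IsSubgroup (group ^ᵍ n) (H i) × IsClosed (powerAtlas G n) (H i)) ×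
      (∀ (b : Variety.Point B) →
        Σ[ I ∈ Subset.Subset m ] Σ[ γ ∈ (Fin m → Gⁿ.Carrier) ]
          (∀ i → γ i ∈ Γⁿ) ×
          closure (powerAtlas G n) ((λ x → (x , b) ∈ X) ∩ Γⁿ)
            ≐ (λ x → ∃[ i ] i Subset.∈ I × x ∈ translate (group ^ᵍ n) (γ i) (H i))))

{-# OPTIONS --safe #-}
module Submission where

-- Let X ⊆ Gⁿ × B be the family. On a chart of B, a point x of a chart of Gⁿ
-- and an equation p of X give the function y ↦ p (x , y); call it a row at x.
-- The rows lie in a finite dimensional space, so the rank k of the rows at the
-- points of X_b ∩ Γⁿ is bounded uniformly in b. Let W be the closure in
-- (Gⁿ)ᵏ⁺¹ of the set of tuples all of whose entries lie in X_b ∩ Γⁿ for some b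
-- of rank at most k. On W any k + 1 rows at the entries are dependent, this
-- being a closed condition. Let b have rank k and let g₁ , … , g_k ∈ X_b ∩ Γⁿ
-- carry independent rows. These rows vanish at b, so a row at γ that does not
-- vanish at b is independent of them; hence γ ∈ Γⁿ lies in X_b if and only if
-- (γ , g₁ , … , g_k) ∈ W. As Γ is of Lang type, W ∩ Γⁿ⁽ᵏ⁺¹⁾ is a finite union
-- of cosets of groups Hᵢ, and so X_b ∩ Γⁿ is a union of cosets of the groups
-- { a ∣ (a , ε , … , ε) ∈ Hᵢ }, which do not depend on b. It remains to take
-- closures; that these are cut out by finitely many polynomials in each chart
-- is Hilbert's basis theorem.

open import Defs
open import Algebra.Apartness.Bundles using (HeytingField; HeytingCommutativeRing)
import Algebra.Apartness.Properties.HeytingCommutativeRing as Apartness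
open import Algebra.Bundles using (CommutativeRing; Group)
import Algebra.Properties.Group as GroupProperties
import Algebra.Properties.Ring as RingProperties
import Algebra.Solver.Ring.NaturalCoefficients.Default as Solver
open import Axiom.ExcludedMiddle using (ExcludedMiddle)
open import Data.Empty.Polymorphic using (⊥)
open import Data.Fin.Base using (Fin; zero; suc; splitAt; join; _↑ˡ_; _↑ʳ_)
open import Data.Fin.Properties using (splitAt-↑ˡ; splitAt-↑ʳ; splitAt-join)
import Data.Fin.Subset as Subset
open import Data.List.Base using (List; []; _∷_; _++_; map; length; concat; upTo; cartesianProductWith)
open import Data.List.Membership.Propositional as List using (find; lose)
open import Data.List.Membership.Propositional.Properties using (∈-++⁺ˡ; ∈-++⁺ʳ; ∈-concat⁺′; ∈-map⁺; ∈-upTo⁺)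
open import Data.List.Properties using (length-map)
open import Data.List.Relation.Unary.All as All using (All; []; _∷_)
import Data.List.Relation.Unary.All.Properties as All
open import Data.List.Relation.Unary.Any using (Any; here; there)
open import Data.Nat.Base as ℕ using (ℕ; zero; suc)
import Data.Nat.Properties as ℕ
open import Data.Product.Base using (Σ; Σ-syntax; ∃-syntax; _×_; _,_; proj₁; proj₂; uncurry)
open import Data.Product.Relation.Binary.Pointwise.NonDependent using (×-setoid)
open import Data.Sum.Base using (_⊎_; inj₁; inj₂; [_,_]; [_,_]′)
open import Data.Unit.Polymorphic.Base using (⊤)
import Data.Vec.Base as Vec
open import Data.Vec.Functional as Vector using (Vector)
open import Data.Vec.Properties using (lookup⇒[]=; []=⇒lookup; lookup∘tabulate)
open import Function.Base using (id; _∘_)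
open import Function.Bundles using (_⇔_; mk⇔; Equivalence)
open import Level using (Level; Lift; lift; lower; _⊔_) renaming (suc to lsuc)
open import Relation.Binary.Bundles using (Setoid)
open import Relation.Binary.Definitions using (_Respects_)
open import Relation.Binary.PropositionalEquality as ≡ using (_≡_)
import Relation.Binary.Reasoning.Setoid as SetoidReasoning
open import Relation.Nullary.Decidable using (dec-true)
open import Relation.Nullary.Decidable.Core using (Dec; yes; no; decidable-stable; does; True; toWitness; fromWitness)
open import Relation.Nullary.Negation.Core using (¬_; contradiction)
open import Relation.Unary using (Pred; _∈_; _∉_; _⊆_; _∩_; _≐_)

-- Field arithmetic under excluded middle

module Field (em : ∀ {a} → ExcludedMiddle a) {ℓ : Level} (K : HeytingField ℓ ℓ ℓ) where

  open HeytingField K hiding (zero)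
  ring : CommutativeRing ℓ ℓ
  ring = HeytingCommutativeRing.commutativeRing heytingCommutativeRing

  open Apartness heytingCommutativeRing public using (1#0; x#0y#0→xy#0; #-congʳ; x-0≈x)
  open RingProperties (CommutativeRing.ring ring) using (-1*x≈-x)
  open Solver (CommutativeRing.commutativeSemiring ring) public using (solve; _:=_; _:+_; _:*_)

  x+-1*x≈0 : ∀ x → x + - 1# * x ≈ 0#
  x+-1*x≈0 x = trans (+-congˡ (-1*x≈-x x)) (-‿inverseʳ x)

  ≉⇒# : ∀ {x y} → ¬ x ≈ y → x # y
  ≉⇒# {x} {y} x≉y = decidable-stable em (λ ¬x#y → x≉y (proj₁ (tight x y) ¬x#y))

  #⇒≉ : ∀ {x y} → x # y → ¬ x ≈ y
  #⇒≉ {x} {y} x#y x≈y = proj₂ (tight x y) x≈y x#y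

  inverse : ∀ {x} → x # 0# → ∃[ y ] y * x ≈ 1#
  inverse {x} x#0 = let y , yx≈1 , _ = #⇒invertible x#0 in y , trans (*-congˡ (sym (x-0≈x x))) yx≈1

  x*y#0⇒x#0 : ∀ {x y} → x * y # 0# → x # 0#
  x*y#0⇒x#0 {x} {y} xy#0 = ≉⇒# λ x≈0 → #⇒≉ xy#0 (trans (*-congʳ x≈0) (zeroˡ y))

  x*y#0⇒y#0 : ∀ {x y} → x * y # 0# → y # 0#
  x*y#0⇒y#0 {x} {y} xy#0 = ≉⇒# λ y≈0 → #⇒≉ xy#0 (trans (*-congˡ y≈0) (zeroʳ x))

-- Hilbert's basis theorem

module HilbertBasis (em : ∀ {a} → ExcludedMiddle a) {ℓ : Level} (K : HeytingField ℓ ℓ ℓ) where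

  open HeytingField K hiding (zero)
  open Field em K
  open SetoidReasoning setoid

  -- Equality as functions, not as formal polynomials. The record wrapper lets `p` and `q` be
  -- inferred from a proof, which the bare pointwise statement would not allow.
  infix 4 _∼_
  record _∼_ {n} (p q : Poly K n) : Set ℓ where
    constructor ∼⁺
    field at : ∀ x → eval p x ≈ eval q x

  open _∼_

  ∼-sym : ∀ {n} {p q : Poly K n} → p ∼ q → q ∼ p
  ∼-sym p∼q .at x = sym (p∼q .at x)

  ∼-trans : ∀ {n} {p q r : Poly K n} → p ∼ q → q ∼ r → p ∼ r
  ∼-trans p∼q q∼r .at x = trans (p∼q .at x) (q∼r .at x)

  record IsIdeal {n} (I : Pred (Poly K n) ℓ) : Set ℓ where
    field
      respects : ∀ {p q} → p ∼ q → p ∈ I → q ∈ I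
      0-closed : con 0# ∈ I
      ⊕-closed : ∀ {p q} → p ∈ I → q ∈ I → p ⊕ q ∈ I
      ⊗-closed : ∀ r {p} → p ∈ I → r ⊗ p ∈ I

  open IsIdeal

  ∩-isIdeal : ∀ {n} {I J : Pred (Poly K n) ℓ} → IsIdeal I → IsIdeal J → IsIdeal (I ∩ J)
  ∩-isIdeal i j = record
    { respects = λ p∼q (p∈I , p∈J) → respects i p∼q p∈I , respects j p∼q p∈J
    ; 0-closed = 0-closed i , 0-closed j
    ; ⊕-closed = λ (p∈I , p∈J) (q∈I , q∈J) → ⊕-closed i p∈I q∈I , ⊕-closed j p∈J q∈J
    ; ⊗-closed = λ r (p∈I , p∈J) → ⊗-closed i r p∈I , ⊗-closed j r p∈J
    }

  -- Generation is expressed by minimality among ideals, which avoids linear combinations.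
  FinitelyGenerated : ∀ {n} → Pred (Poly K n) ℓ → Set (lsuc ℓ)
  FinitelyGenerated {n} I =
    Σ[ gs ∈ List (Poly K n) ] All I gs × (∀ J → IsIdeal J → All J gs → I ⊆ J)

  -- Degree in the first variable

  pow : ∀ {n} → ℕ → Poly K (suc n)
  pow zero    = con 1#
  pow (suc d) = var zero ⊗ pow d

  -- A polynomial in n + 1 variables is read as one in t = `var zero` with coefficients in the
  -- remaining variables: a top term a tᵈ and a rest s.
  lead : ∀ {n} → ℕ → Poly K n → Poly K (suc n) → Poly K (suc n)
  lead d a s = rename suc a ⊗ pow d ⊕ s

  -- Only the existence of an expansion is asserted. The top coefficient may be zero, and the
  -- expansion need not be unique.
  Degree< : ∀ {n} → ℕ → Pred (Poly K (suc n)) ℓ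
  Degree< zero    p = p ∼ con 0#
  Degree< (suc d) p = ∃[ a ] ∃[ s ] s ∈ Degree< d × p ∼ lead d a s

  rename-cong : ∀ {n} {p q : Poly K n} → p ∼ q → rename suc p ∼ rename suc q
  rename-cong {p = p} {q} p∼q .at x = begin
    eval (rename suc p) x ≡⟨ eval-rename suc p x ⟩
    eval p (x ∘ suc)      ≈⟨ p∼q .at (x ∘ suc) ⟩
    eval q (x ∘ suc)      ≡⟨ eval-rename suc q x ⟨
    eval (rename suc q) x ∎

  lead-⊕ : ∀ {n} d (a b : Poly K n) s t → lead d a s ⊕ lead d b t ∼ lead d (a ⊕ b) (s ⊕ t)
  lead-⊕ d a b s t .at x =
    solve 5 (λ a b m s t → (a :* m :+ s) :+ (b :* m :+ t) := (a :+ b) :* m :+ (s :+ t)) refl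
      (eval (rename suc a) x) (eval (rename suc b) x) (eval (pow d) x) (eval s x) (eval t x)

  lead-⊗ : ∀ {n} d r (a : Poly K n) s → rename suc r ⊗ lead d a s ∼ lead d (r ⊗ a) (rename suc r ⊗ s)
  lead-⊗ d r a s .at x =
    solve 4 (λ r a m s → r :* (a :* m :+ s) := (r :* a) :* m :+ r :* s) refl
      (eval (rename suc r) x) (eval (rename suc a) x) (eval (pow d) x) (eval s x)

  infixl 6 _⊖_
  _⊖_ : ∀ {n} → Poly K n → Poly K n → Poly K n
  p ⊖ q = p ⊕ con (- 1#) ⊗ q

  ⊖-cong : ∀ {n} {p q r : Poly K n} → p ∼ q → p ⊖ r ∼ q ⊖ r
  ⊖-cong p∼q .at x = +-congʳ (p∼q .at x)

  ⊖-⊕ : ∀ {n} (p q : Poly K n) → p ⊖ q ⊕ q ∼ p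
  ⊖-⊕ p q .at x = begin
    (eval p x + - 1# * eval q x) + eval q x ≈⟨ +-assoc _ _ _ ⟩
    eval p x + (- 1# * eval q x + eval q x) ≈⟨ +-congˡ (trans (+-comm _ _) (x+-1*x≈0 (eval q x))) ⟩
    eval p x + 0#                           ≈⟨ +-identityʳ _ ⟩
    eval p x                                ∎

  lead-⊖ : ∀ {n} d (a : Poly K n) s t → lead d a s ⊖ lead d a t ∼ s ⊖ t
  lead-⊖ d a s t .at x = begin
    (m + eval s x) + - 1# * (m + eval t x)
      ≈⟨ solve 4 (λ m s t n → (m :+ s) :+ n :* (m :+ t) := (s :+ n :* t) :+ (m :+ n :* m)) refl
           m (eval s x) (eval t x) (- 1#) ⟩
    eval (s ⊖ t) x + (m + - 1# * m) ≈⟨ +-congˡ (x+-1*x≈0 m) ⟩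
    eval (s ⊖ t) x + 0#             ≈⟨ +-identityʳ _ ⟩
    eval (s ⊖ t) x                  ∎
    where m = eval (rename suc a) x * eval (pow d) x

  lead-suc : ∀ {n} d (a : Poly K n) s → var zero ⊗ lead d a s ∼ lead (suc d) a (var zero ⊗ s)
  lead-suc d a s .at x =
    solve 4 (λ t a m s → t :* (a :* m :+ s) := a :* (t :* m) :+ t :* s) refl
      (x zero) (eval (rename suc a) x) (eval (pow d) x) (eval s x)

  lead-0 : ∀ {n} d (s : Poly K (suc n)) → s ∼ lead d (con 0#) s
  lead-0 d s .at x = sym (trans (+-congʳ (zeroˡ _)) (+-identityˡ _))

  degree-respects : ∀ {n} d {p q : Poly K (suc n)} → p ∼ q → p ∈ Degree< d → q ∈ Degree< d
  degree-respects zero    p∼q p∼0               = ∼-trans (∼-sym p∼q) p∼0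
  degree-respects (suc d) p∼q (a , s , s∈ , p∼) = a , s , s∈ , ∼-trans (∼-sym p∼q) p∼

  degree-suc : ∀ {n} d {p : Poly K (suc n)} → p ∈ Degree< d → p ∈ Degree< (suc d)
  degree-suc d {p} p∈ = con 0# , p , p∈ , lead-0 d p

  degree-+ : ∀ {n} d e {p : Poly K (suc n)} → p ∈ Degree< d → p ∈ Degree< (e ℕ.+ d)
  degree-+ d zero    p∈ = p∈
  degree-+ d (suc e) p∈ = degree-suc (e ℕ.+ d) (degree-+ d e p∈)

  degree-0 : ∀ {n} d → con 0# ∈ Degree< {n} d
  degree-0 zero    = ∼⁺ λ _ → refl
  degree-0 (suc d) = degree-suc d (degree-0 d)

  degree-⊕ : ∀ {n} d {p q : Poly K (suc n)} → p ∈ Degree< d → q ∈ Degree< d → p ⊕ q ∈ Degree< d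
  degree-⊕ zero    p∼0 q∼0 = ∼⁺ λ x → trans (+-cong (p∼0 .at x) (q∼0 .at x)) (+-identityˡ 0#)
  degree-⊕ (suc d) (a , s , s∈ , p∼) (b , t , t∈ , q∼) =
    a ⊕ b , s ⊕ t , degree-⊕ d s∈ t∈ , ∼⁺ λ x → trans (+-cong (p∼ .at x) (q∼ .at x)) (lead-⊕ d a b s t .at x)

  degree-⊗ : ∀ {n} d r {p : Poly K (suc n)} → p ∈ Degree< d → rename suc r ⊗ p ∈ Degree< d
  degree-⊗ zero    r p∼0 = ∼⁺ λ x → trans (*-congˡ (p∼0 .at x)) (zeroʳ _)
  degree-⊗ (suc d) r (a , s , s∈ , p∼) =
    r ⊗ a , rename suc r ⊗ s , degree-⊗ d r s∈ , ∼⁺ λ x → trans (*-congˡ (p∼ .at x)) (lead-⊗ d r a s .at x)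

  degree-var : ∀ {n} d {p : Poly K (suc n)} → p ∈ Degree< d → var zero ⊗ p ∈ Degree< (suc d)
  degree-var zero p∼0 = degree-suc 0 (∼⁺ λ x → trans (*-congˡ (p∼0 .at x)) (zeroʳ _))
  degree-var (suc d) (a , s , s∈ , p∼) =
    a , var zero ⊗ s , degree-var d s∈ , ∼⁺ λ x → trans (*-congˡ (p∼ .at x)) (lead-suc d a s .at x)

  HasDegree : ∀ {n} → Pred (Poly K (suc n)) ℓ
  HasDegree p = ∃[ d ] p ∈ Degree< d

  hasDegree-respects : ∀ {n} {p q : Poly K (suc n)} → p ∼ q → p ∈ HasDegree → q ∈ HasDegree
  hasDegree-respects p∼q (d , p∈) = d , degree-respects d p∼q p∈

  hasDegree-⊕ : ∀ {n} {p q : Poly K (suc n)} → p ∈ HasDegree → q ∈ HasDegree → p ⊕ q ∈ HasDegree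
  hasDegree-⊕ {q = q} (d , p∈) (e , q∈) =
    e ℕ.+ d , degree-⊕ (e ℕ.+ d) (degree-+ d e p∈)
                (≡.subst (λ k → q ∈ Degree< k) (ℕ.+-comm d e) (degree-+ e d q∈))

  hasDegree-pow : ∀ {n} d {p : Poly K (suc n)} → p ∈ HasDegree → pow d ⊗ p ∈ HasDegree
  hasDegree-pow zero    p∈ = hasDegree-respects (∼⁺ λ x → sym (*-identityˡ _)) p∈
  hasDegree-pow (suc d) p∈ =
    let e , q∈ = hasDegree-pow d p∈
    in  suc e , degree-respects (suc e) (∼⁺ λ x → sym (*-assoc _ _ _)) (degree-var e q∈)

  -- Induction on the expansion of p: with p = a tᵈ + s the product is a (tᵈ q) + s q.
  hasDegree-⊗ : ∀ {n} d {p q : Poly K (suc n)} → p ∈ Degree< d → q ∈ HasDegree → p ⊗ q ∈ HasDegree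
  hasDegree-⊗ zero p∼0 q∈ = 0 , ∼⁺ λ x → trans (*-congʳ (p∼0 .at x)) (zeroˡ _)
  hasDegree-⊗ (suc d) {p} {q} (a , s , s∈ , p∼) q∈ =
    let e , r∈ = hasDegree-pow d q∈
    in  hasDegree-respects
          (∼⁺ λ x → trans
            (solve 4 (λ a m s q → a :* (m :* q) :+ s :* q := (a :* m :+ s) :* q) refl
               (eval (rename suc a) x) (eval (pow d) x) (eval s x) (eval q x))
            (*-congʳ (sym (p∼ .at x))))
          (hasDegree-⊕ (e , degree-⊗ e a r∈) (hasDegree-⊗ d s∈ q∈))

  hasDegree : ∀ {n} (p : Poly K (suc n)) → p ∈ HasDegree
  hasDegree (con a) =
    1 , con a , con 0# , ∼⁺ (λ _ → refl) , ∼⁺ λ _ → sym (trans (+-identityʳ _) (*-identityʳ a))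
  hasDegree (var zero) =
    hasDegree-respects {p = var zero ⊗ con 1#} (∼⁺ λ _ → *-identityʳ _) (2 , degree-var 1
      (con 1# , con 0# , ∼⁺ (λ _ → refl) , ∼⁺ λ _ → sym (trans (+-identityʳ _) (*-identityʳ _))))
  hasDegree (var (suc i)) =
    1 , var i , con 0# , ∼⁺ (λ _ → refl) , ∼⁺ λ _ → sym (trans (+-identityʳ _) (*-identityʳ _))
  hasDegree (p ⊕ q) = hasDegree-⊕ (hasDegree p) (hasDegree q)
  hasDegree (p ⊗ q) = let d , p∈ = hasDegree p in hasDegree-⊗ d p∈ (hasDegree q)

  -- The ideals of leading coefficients from the classical proof of the basis theorem, one for each
  -- degree. They contain 0 and increase with d.
  LeadingCoefficients : ∀ {n} → Pred (Poly K (suc n)) ℓ → ℕ → Pred (Poly K n) ℓ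
  LeadingCoefficients I d a = ∃[ s ] s ∈ Degree< d × lead d a s ∈ I

  module _ {n} {I : Pred (Poly K (suc n)) ℓ} (isIdeal : IsIdeal I) where

    private
      L = LeadingCoefficients I

    -- Multiplication by t raises the degree by one and keeps the leading coefficient.
    leading-suc : ∀ d → L d ⊆ L (suc d)
    leading-suc d {a} (s , s∈ , m∈I) =
      var zero ⊗ s , degree-var d s∈
      , respects isIdeal (lead-suc d a s) (⊗-closed isIdeal (var zero) m∈I)

    leading-+ : ∀ d e → L d ⊆ L (e ℕ.+ d)
    leading-+ d zero    a∈ = a∈
    leading-+ d (suc e) a∈ = leading-suc (e ℕ.+ d) (leading-+ d e a∈)

    leading-≤ : ∀ {d e} → d ℕ.≤ e → L d ⊆ L e
    leading-≤ {d} {e} d≤e {a} a∈ =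
      ≡.subst (λ k → a ∈ L k) (ℕ.m∸n+n≡m d≤e) (leading-+ d (e ℕ.∸ d) a∈)

    leading-isIdeal : ∀ d → IsIdeal (L d)
    leading-isIdeal d = record
      { respects = λ p∼q (s , s∈ , m∈I) → s , s∈
          , respects isIdeal (∼⁺ λ x → +-congʳ (*-congʳ (rename-cong p∼q .at x))) m∈I
      ; 0-closed = con 0# , degree-0 d , respects isIdeal (lead-0 d (con 0#)) (0-closed isIdeal)
      ; ⊕-closed = λ {a} {b} (s , s∈ , m∈I) (t , t∈ , m′∈I) → s ⊕ t , degree-⊕ d s∈ t∈
          , respects isIdeal (lead-⊕ d a b s t) (⊕-closed isIdeal m∈I m′∈I)
      ; ⊗-closed = λ r {a} (s , s∈ , m∈I) → rename suc r ⊗ s , degree-⊗ d r s∈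
          , respects isIdeal (lead-⊗ d r a s) (⊗-closed isIdeal (rename suc r) m∈I)
      }

    -- An increasing union of ideals: two members can be brought to a common degree before they are
    -- added.
    leading-∃-isIdeal : IsIdeal (λ a → ∃[ d ] a ∈ L d)
    leading-∃-isIdeal = record
      { respects = λ p∼q (d , p∈) → d , respects (leading-isIdeal d) p∼q p∈
      ; 0-closed = 0 , 0-closed (leading-isIdeal 0)
      ; ⊕-closed = λ (d , p∈) (e , q∈) → d ℕ.⊔ e
          , ⊕-closed (leading-isIdeal (d ℕ.⊔ e)) (leading-≤ (ℕ.m≤m⊔n d e) p∈) (leading-≤ (ℕ.m≤n⊔m d e) q∈)
      ; ⊗-closed = λ r (d , p∈) → d , ⊗-closed (leading-isIdeal d) r p∈
      }

  module _ {n} {I : Pred (Poly K (suc n)) ℓ} (isIdeal : IsIdeal I) where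

    private
      L = LeadingCoefficients I

    -- Finitely many generators of the union of the chain already lie in one of its members; this is
    -- the degree from which the chain is constant.
    leading-bound : ∀ {as} → All (λ a → ∃[ d ] a ∈ L d) as → ∃[ d ] All (L d) as
    leading-bound [] = 0 , []
    leading-bound ((d , a∈) ∷ as∈) =
      let e , as∈′ = leading-bound as∈
      in  d ℕ.⊔ e , leading-≤ isIdeal (ℕ.m≤m⊔n d e) a∈ ∷ All.map (leading-≤ isIdeal (ℕ.m≤n⊔m d e)) as∈′

    lifts : ∀ d {as} → All (L d) as → List (Poly K (suc n))
    lifts d []                        = []
    lifts d (_∷_ {x = a} (s , _) as∈) = lead d a s ∷ lifts d as∈

    lifts-⊆ : ∀ d {as} (as∈ : All (L d) as) → All I (lifts d as∈)
    lifts-⊆ d []                    = []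
    lifts-⊆ d ((s , _ , m∈I) ∷ as∈) = m∈I ∷ lifts-⊆ d as∈

    lifts-leading : ∀ d {as} (as∈ : All (L d) as) {J : Pred (Poly K (suc n)) ℓ} →
                    All J (lifts d as∈) →
                    All (LeadingCoefficients (I ∩ J) d) as
    lifts-leading d []                     []           = []
    lifts-leading d ((s , s∈ , m∈I) ∷ as∈) (m∈J ∷ ms∈J) =
      (s , s∈ , m∈I , m∈J) ∷ lifts-leading d as∈ ms∈J

    -- By induction on the degree: subtract an element of I ∩ J with the same leading coefficient.
    leading-⊆ : ∀ {J} → IsIdeal J → (∀ d → L d ⊆ LeadingCoefficients (I ∩ J) d) → I ⊆ J
    leading-⊆ {J} isIdealJ L⊆ {p} p∈I = let d , p∈ = hasDegree p in go d p∈ p∈I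
      where
      go : ∀ d {p} → p ∈ Degree< d → p ∈ I → p ∈ J
      go zero    p∼0 p∈I = respects isIdealJ (∼-sym p∼0) (0-closed isIdealJ)
      go (suc d) (a , s , s∈ , p∼) p∈I =
        let t , t∈ , m∈I , m∈J = L⊆ d (s , s∈ , respects isIdeal p∼ p∈I)
            p⊖m∼s⊖t = ∼-trans (⊖-cong p∼) (lead-⊖ d a s t)
            p⊖m∈I = ⊕-closed isIdeal p∈I (⊗-closed isIdeal (con (- 1#)) m∈I)
            s⊖t∈J = go d (degree-⊕ d s∈ (degree-⊗ d (con (- 1#)) t∈)) (respects isIdeal p⊖m∼s⊖t p⊖m∈I)
            p⊖m∈J = respects isIdealJ (∼-sym p⊖m∼s⊖t) s⊖t∈J
        in  respects isIdealJ (⊖-⊕ _ _) (⊕-closed isIdealJ p⊖m∈J m∈J)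

    -- With D a degree at which all generators of the union of the `L d` occur, I is generated by
    -- elements realising these generators in degree D together with, for each d < D, elements
    -- realising generators of `L d`. An ideal J containing them has I ∩ J with the same leading
    -- coefficients as I in every degree, and `leading-⊆` applies.
    hilbert-step : (∀ (J : Pred (Poly K n) ℓ) → IsIdeal J → FinitelyGenerated J) → FinitelyGenerated I
    hilbert-step noetherian = lifts D as∈ ++ gens D , All.++⁺ (lifts-⊆ D as∈) (gens-⊆ D) , least
      where
      all-basis = noetherian _ (leading-∃-isIdeal isIdeal)
      as-least  = proj₂ (proj₂ all-basis)
      bound     = leading-bound (proj₁ (proj₂ all-basis))
      D         = proj₁ bound
      as∈       = proj₂ bound

      basis : ∀ d → FinitelyGenerated (L d)
      basis d = noetherian _ (leading-isIdeal isIdeal d)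

      basis∈ = λ d → proj₁ (proj₂ (basis d))

      gens : ℕ → List (Poly K (suc n))
      gens zero    = []
      gens (suc d) = lifts d (basis∈ d) ++ gens d

      gens-⊆ : ∀ d → All I (gens d)
      gens-⊆ zero    = []
      gens-⊆ (suc d) = All.++⁺ (lifts-⊆ d (basis∈ d)) (gens-⊆ d)

      least : ∀ J → IsIdeal J → All J (lifts D as∈ ++ gens D) → I ⊆ J
      least J isIdealJ gs∈J = leading-⊆ isIdealJ λ d {a} a∈ → case-≤ d a∈ (ℕ.≤-<-connex D d)
        where
        I∩J = ∩-isIdeal isIdeal isIdealJ
        L′-isIdeal = leading-isIdeal I∩J
        L′ = LeadingCoefficients (I ∩ J)
        small : ∀ {d} e → All J (gens e) → d ℕ.< e → L d ⊆ L′ d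
        small {d} (suc e) gs∈J d<1+e with ℕ.m≤n⇒m<n∨m≡n (ℕ.s≤s⁻¹ d<1+e)
        ... | inj₁ d<e    = small e (All.++⁻ʳ _ gs∈J) d<e
        ... | inj₂ ≡.refl =
          proj₂ (proj₂ (basis d)) (L′ d) (L′-isIdeal d) (lifts-leading d (basis∈ d) (All.++⁻ˡ _ gs∈J))
        case-≤ : ∀ d {a} → a ∈ L d → D ℕ.≤ d ⊎ d ℕ.< D → a ∈ L′ d
        case-≤ d a∈ (inj₂ d<D) = small D (All.++⁻ʳ _ gs∈J) d<D a∈
        -- The generators chosen in degree D generate the whole union, which contains `L d`; powers
        -- of t then carry the coefficient from degree D up to d.
        case-≤ d a∈ (inj₁ D≤d) = leading-≤ I∩J D≤d
          (as-least (L′ D) (L′-isIdeal D) (lifts-leading D as∈ (All.++⁻ˡ _ gs∈J)) (d , a∈))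

  hilbert-basis : ∀ n (I : Pred (Poly K n) ℓ) → IsIdeal I → FinitelyGenerated I
  hilbert-basis (suc n) I isIdeal = hilbert-step isIdeal (hilbert-basis n)
  -- Without variables all polynomials are constant, so an ideal is zero or contains a unit.
  hilbert-basis zero I isIdeal with em {P = ∃[ p ] p ∈ I × eval p (λ ()) # 0#}
  ... | yes (p , p∈I , p#0) = p ∷ [] , p∈I ∷ [] , λ where
    J isIdealJ (p∈J ∷ []) {q} q∈I →
      let y , yp≈1 = inverse p#0
      in  respects isIdealJ
            (∼⁺ λ x → begin
              (eval q x * y) * eval p x ≈⟨ *-assoc _ _ _ ⟩
              eval q x * (y * eval p x) ≈⟨ *-congˡ (*-congˡ (eval-cong p λ ())) ⟩
              eval q x * (y * eval p (λ ())) ≈⟨ *-congˡ yp≈1 ⟩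
              eval q x * 1# ≈⟨ *-identityʳ _ ⟩
              eval q x ∎)
            (⊗-closed isIdealJ (q ⊗ con y) p∈J)
  ... | no ∄ = [] , [] , λ J isIdealJ _ {q} q∈I →
    respects isIdealJ
      (∼⁺ λ x → sym (trans (eval-cong q λ ()) (proj₁ (tight _ _) λ q#0 → ∄ (q , q∈I , q#0))))
      (0-closed isIdealJ)

-- The Zariski topology

module Topology (em : ∀ {a} → ExcludedMiddle a) {ℓ : Level} (K : HeytingField ℓ ℓ ℓ) where

  private
    module K where
      open HeytingField K public hiding (zero)
      open Field em K public
  open HilbertBasis em K using (IsIdeal; hilbert-basis; _∼_)
  open _∼_

  ∏ : ∀ {n r} → (Fin r → Poly K n) → Poly K n
  ∏ {r = zero}  qs = con K.1#
  ∏ {r = suc r} qs = qs zero ⊗ ∏ (qs ∘ suc)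

  ∏-#0⁺ : ∀ {n r} (qs : Fin r → Poly K n) {x} → (∀ i → eval (qs i) x K.# K.0#) → eval (∏ qs) x K.# K.0#
  ∏-#0⁺ {r = zero}  qs qs#0 = K.1#0
  ∏-#0⁺ {r = suc r} qs qs#0 = K.x#0y#0→xy#0 (qs#0 zero) (∏-#0⁺ (qs ∘ suc) (qs#0 ∘ suc))

  ∏-#0⁻ : ∀ {n r} (qs : Fin r → Poly K n) {x} → eval (∏ qs) x K.# K.0# → ∀ i → eval (qs i) x K.# K.0#
  ∏-#0⁻ qs ∏#0 zero    = K.x*y#0⇒x#0 ∏#0
  ∏-#0⁻ qs ∏#0 (suc i) = ∏-#0⁻ (qs ∘ suc) (K.x*y#0⇒y#0 ∏#0) i

  module _ {S : Setoid ℓ ℓ} (A : Atlas K S) where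

    open Setoid S
    open Atlas A

    -- A pointwise form of closedness, with one polynomial for each point outside Z in place of a
    -- finite list of equations for the whole chart.
    IsSeparated : Pred Carrier ℓ → Set ℓ
    IsSeparated Z = ∀ c u → point c u ∉ Z →
      Σ[ q ∈ Poly K (dim c) ] eval q (proj₁ u) K.# K.0# × (∀ x → point c x ∈ Z → eval q (proj₁ x) K.≈ K.0#)

    closed⇒separated : ∀ {Z} → IsClosed A Z → IsSeparated Z
    closed⇒separated {Z} closed c u u∉Z =
      let ps , Z⇔ps = IsClosed.locally closed c
          q , q∈ps , qu≉0 = find (All.¬All⇒Any¬ (λ _ → em) ps (u∉Z ∘ Equivalence.from (Z⇔ps u)))
      in  q , K.≉⇒# qu≉0 , λ x x∈Z → All.lookup (Equivalence.to (Z⇔ps x) x∈Z) q∈ps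

    -- By Hilbert's basis theorem finitely many polynomials generate the ideal of those vanishing on
    -- Z in a chart. The polynomials vanishing at a given point also form an ideal, so a common zero
    -- of the generators is a zero of every polynomial vanishing on Z, and no such polynomial can
    -- separate it from Z.
    separated⇒closed : ∀ {Z} → Z Respects _≈_ → IsSeparated Z → IsClosed A Z
    separated⇒closed {Z} Z-resp separated = record { respects = Z-resp ; locally = locally }
      where
      Vanishing : ∀ c → Pred (Poly K (dim c)) ℓ
      Vanishing c p = ∀ x → point c x ∈ Z → eval p (proj₁ x) K.≈ K.0#

      vanishing-isIdeal : ∀ c → IsIdeal (Vanishing c)
      vanishing-isIdeal c = record
        { respects = λ p∼q p∈ x x∈Z → K.trans (K.sym (p∼q .at (proj₁ x))) (p∈ x x∈Z)
        ; 0-closed = λ x x∈Z → K.refl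
        ; ⊕-closed = λ p∈ q∈ x x∈Z → K.trans (K.+-cong (p∈ x x∈Z) (q∈ x x∈Z)) (K.+-identityˡ K.0#)
        ; ⊗-closed = λ r p∈ x x∈Z → K.trans (K.*-congˡ (p∈ x x∈Z)) (K.zeroʳ _)
        }

      evaluation-isIdeal : ∀ {n} (x : Vector K.Carrier n) → IsIdeal (λ p → eval p x K.≈ K.0#)
      evaluation-isIdeal x = record
        { respects = λ p∼q p∈ → K.trans (K.sym (p∼q .at x)) p∈
        ; 0-closed = K.refl
        ; ⊕-closed = λ p∈ q∈ → K.trans (K.+-cong p∈ q∈) (K.+-identityˡ K.0#)
        ; ⊗-closed = λ r p∈ → K.trans (K.*-congˡ p∈) (K.zeroʳ _)
        }

      locally : ∀ c → Σ[ ps ∈ List (Poly K (dim c)) ] (∀ u → point c u ∈ Z ⇔ proj₁ u ∈ Zeros ps)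
      locally c =
        let ps , ps∈ , least = hilbert-basis (dim c) (Vanishing c) (vanishing-isIdeal c)
        in  ps , λ u → mk⇔
              (λ u∈Z → All.map (λ p∈ → p∈ u u∈Z) ps∈)
              (λ u∈ps → decidable-stable em λ u∉Z →
                let q , qu#0 , q∈ = separated c u u∉Z
                in  K.#⇒≉ qu#0 (least _ (evaluation-isIdeal (proj₁ u)) u∈ps {q} q∈))

    -- The hypothesis exhibits Z as an intersection of closed sets, possibly infinite; a polynomial
    -- separating a point from one of them separates it from Z.
    supersets⇒closed : ∀ {Z} → Z Respects _≈_ →
                       (∀ {s} → s ∉ Z → ∃[ W ] IsClosed A W × Z ⊆ W × s ∉ W) → IsClosed A Z
    supersets⇒closed Z-resp supersets = separated⇒closed Z-resp λ c u u∉Z →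
      let W , W-closed , Z⊆W , u∉W = supersets u∉Z
          q , qu#0 , q≈0 = closed⇒separated W-closed c u u∉W
      in  q , qu#0 , λ x x∈Z → q≈0 x (Z⊆W x∈Z)

    -- The product of polynomials separating a point from each member separates it from the finite
    -- union.
    ⋃-isClosed : ∀ {m} {Z : Fin m → Pred Carrier ℓ} → (∀ i → IsClosed A (Z i)) →
                 IsClosed A (λ s → ∃[ i ] s ∈ Z i)
    ⋃-isClosed {Z = Z} closed = separated⇒closed
      (λ s≈t (i , s∈) → i , IsClosed.respects (closed i) s≈t s∈)
      λ c u u∉ →
        let q = λ i → closed⇒separated (closed i) c u (λ u∈ → u∉ (i , u∈))
            qs = λ i → proj₁ (q i)
        in  ∏ qs , ∏-#0⁺ qs (λ i → proj₁ (proj₂ (q i))) , λ x (i , x∈) →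
              decidable-stable em λ ∏≉0 →
                K.#⇒≉ (∏-#0⁻ qs (K.≉⇒# ∏≉0) i) (proj₂ (proj₂ (q i)) x x∈)

    -- closure A P lives one universe above the predicates that IsClosed accepts.
    cl : Pred Carrier ℓ → Pred Carrier ℓ
    cl P s = Lift ℓ (True (em {P = s ∈ closure A P}))

    closure⊆cl : ∀ {P} → closure A P ⊆ cl P
    closure⊆cl s∈ = lift (fromWitness s∈)

    cl⊆closure : ∀ {P} → cl P ⊆ closure A P
    cl⊆closure s∈ = toWitness (lower s∈)

    ⊆cl : ∀ {P} → P ⊆ cl P
    ⊆cl s∈P = closure⊆cl λ Z Z-closed P⊆Z → P⊆Z s∈P

    cl-least : ∀ {P Z} → IsClosed A Z → P ⊆ Z → cl P ⊆ Z
    cl-least Z-closed P⊆Z s∈ = cl⊆closure s∈ _ Z-closed P⊆Z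

    cl-isClosed : ∀ P → IsClosed A (cl P)
    cl-isClosed P = supersets⇒closed
      (λ s≈t s∈ → closure⊆cl λ Z Z-closed P⊆Z → IsClosed.respects Z-closed s≈t (cl-least Z-closed P⊆Z s∈))
      λ {s} s∉ → decidable-stable (em {P = ∃[ W ] IsClosed A W × cl P ⊆ W × s ∉ W}) λ ∄ →
        s∉ (closure⊆cl λ Z Z-closed P⊆Z → decidable-stable em λ s∉Z →
          ∄ (Z , Z-closed , (λ x∈ → cl-least Z-closed P⊆Z x∈) , s∉Z))

    -- Rational functions on basic open sets

    module _ (c : Chart) (g : Poly K (dim c)) where

      Domain : Set ℓ
      Domain = Σ[ x ∈ Coords c ] eval g (proj₁ x) K.# K.0#

      value : Poly K (dim c) → Domain → K.Carrier
      value p (x , _) = eval p (proj₁ x)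

      -- One quotient must represent φ on all of g ≠ 0. Denominators are cleared, so no division
      -- occurs.
      record IsRational (φ : Domain → K.Carrier) : Set ℓ where
        constructor rational
        field
          denominator   : Poly K (dim c)
          numerator     : Poly K (dim c)
          denominator#0 : ∀ x → value denominator x K.# K.0#
          quotient      : ∀ x → value denominator x K.* φ x K.≈ value numerator x

    module _ {c : Chart} {g : Poly K (dim c)} where

      rational-con : ∀ a → IsRational c g (λ _ → a)
      rational-con a = rational (con K.1#) (con a) (λ _ → K.1#0) (λ _ → K.*-identityˡ a)

      rational-+ : ∀ {φ ψ} → IsRational c g φ → IsRational c g ψ → IsRational c g (λ x → φ x K.+ ψ x)
      rational-+ {φ} {ψ} (rational e p e#0 eφ≈p) (rational f q f#0 fψ≈q) = rational
        (e ⊗ f) (p ⊗ f ⊕ e ⊗ q) (λ x → K.x#0y#0→xy#0 (e#0 x) (f#0 x))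
        λ x → K.trans
          (K.solve 4 (λ e f a b → (e K.:* f) K.:* (a K.:+ b) K.:= (e K.:* a) K.:* f K.:+ e K.:* (f K.:* b)) K.refl
             (value c g e x) (value c g f x) (φ x) (ψ x))
          (K.+-cong (K.*-congʳ (eφ≈p x)) (K.*-congˡ (fψ≈q x)))

      rational-* : ∀ {φ ψ} → IsRational c g φ → IsRational c g ψ → IsRational c g (λ x → φ x K.* ψ x)
      rational-* {φ} {ψ} (rational e p e#0 eφ≈p) (rational f q f#0 fψ≈q) = rational
        (e ⊗ f) (p ⊗ q) (λ x → K.x#0y#0→xy#0 (e#0 x) (f#0 x))
        λ x → K.trans
          (K.solve 4 (λ e f a b → (e K.:* f) K.:* (a K.:* b) K.:= (e K.:* a) K.:* (f K.:* b)) K.refl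
             (value c g e x) (value c g f x) (φ x) (ψ x))
          (K.*-cong (eφ≈p x) (fψ≈q x))

      rational-eval : ∀ {n} {y : Domain c g → Vector K.Carrier n} (p : Poly K n) →
                      (∀ k → IsRational c g (λ x → y x k)) → IsRational c g (λ x → eval p (y x))
      rational-eval (con a) y-rat = rational-con a
      rational-eval (var k) y-rat = y-rat k
      rational-eval (p ⊕ q) y-rat = rational-+ (rational-eval p y-rat) (rational-eval q y-rat)
      rational-eval (p ⊗ q) y-rat = rational-* (rational-eval p y-rat) (rational-eval q y-rat)

  module _ {S T : Setoid ℓ ℓ} {A : Atlas K S} {B : Atlas K T} where

    private
      module S = Setoid S
      module T = Setoid T
      module A = Atlas A
      module B = Atlas B

    -- Where some f i s lies outside the chart d i the condition on s is void.
    module _ {r} {f : Fin r → S.Carrier → T.Carrier} (f-cong : ∀ i {s t} → s S.≈ t → f i s T.≈ f i t)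
             (f-regular : ∀ i → IsRegular A B (f i)) (d : Fin r → B.Chart)
             (Ψ : (∀ i → B.Coords (d i)) → K.Carrier)
             (Ψ-cong : ∀ {v w} → (∀ i k → proj₁ (v i) k K.≈ proj₁ (w i) k) → Ψ v K.≈ Ψ w)
             (Ψ-rational : ∀ c g (y : Domain A c g → ∀ i → B.Coords (d i)) →
                           (∀ i k → IsRational A c g (λ x → proj₁ (y x i) k)) →
                           IsRational A c g (λ x → Ψ (y x)))
             where

      zeros-isClosed : IsClosed A (λ s → ∀ v → (∀ i → f i s T.≈ B.point (d i) (v i)) → Ψ v K.≈ K.0#)
      zeros-isClosed = separated⇒closed A
        (λ s≈t Ψ≈0 v t↦v → Ψ≈0 v (λ i → T.trans (f-cong i s≈t) (t↦v i)))
        λ c u u∉ → separate c u (decidable-stable em λ ∄ → u∉ λ v u↦v →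
          decidable-stable em λ Ψv≉0 → ∄ (v , u↦v , K.≉⇒# Ψv≉0))
        where
        separate : ∀ c u → (∃[ v ] (∀ i → f i (A.point c u) T.≈ B.point (d i) (v i)) × Ψ v K.# K.0#) →
                   Σ[ q ∈ Poly K (A.dim c) ] eval q (proj₁ u) K.# K.0# ×
                     (∀ x → (∀ v → (∀ i → f i (A.point c x) T.≈ B.point (d i) (v i)) → Ψ v K.≈ K.0#) →
                            eval q (proj₁ x) K.≈ K.0#)
        -- Where g ≠ 0 the coordinates of all `f i` are quotients, so Ψ of them is a quotient too.
        -- Its numerator times g vanishes at every point satisfying the condition: either g vanishes
        -- there, or Ψ does.
        separate c u (v , u↦v , Ψv#0) = g ⊗ numerator , K.x#0y#0→xy#0 gu#0 nu#0 , λ x x∈ →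
          decidable-stable em λ gn≉0 →
            let gn#0 = K.≉⇒# gn≉0
                x∈D = x , K.x*y#0⇒x#0 gn#0
            in  K.#⇒≉ (K.x*y#0⇒y#0 gn#0)
                  (K.trans (K.sym (quotient x∈D)) (K.trans (K.*-congˡ (x∈ (y x∈D) (y-point x∈D))) (K.zeroʳ _)))
          where
          local = λ i → f-regular i c (d i) u (v i) (u↦v i)
          gs = λ i → proj₁ (local i)
          g = ∏ gs
          gu#0 = ∏-#0⁺ gs (λ i → proj₁ (proj₂ (proj₂ (local i))))

          y : Domain A c g → ∀ i → B.Coords (d i)
          y (x , gx#0) i = proj₁ (proj₂ (proj₂ (proj₂ (local i))) x (∏-#0⁻ gs gx#0 i))

          y-point : ∀ x i → f i (A.point c (proj₁ x)) T.≈ B.point (d i) (y x i)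
          y-point (x , gx#0) i = proj₁ (proj₂ (proj₂ (proj₂ (proj₂ (local i))) x (∏-#0⁻ gs gx#0 i)))

          y-rational : ∀ i k → IsRational A c g (λ x → proj₁ (y x i) k)
          y-rational i k = rational (gs i) (proj₁ (proj₂ (local i)) k)
            (λ (x , gx#0) → ∏-#0⁻ gs gx#0 i)
            (λ (x , gx#0) → proj₂ (proj₂ (proj₂ (proj₂ (proj₂ (local i))) x (∏-#0⁻ gs gx#0 i))) k)

          open IsRational (Ψ-rational c g y y-rational)

          u∈D : Domain A c g
          u∈D = u , gu#0

          nu#0 : eval numerator (proj₁ u) K.# K.0#
          -- Both `v` and `y u∈D` are coordinates of the images of u, so they agree by injectivity
          -- of the charts, and Ψ is nonzero on either.
          nu#0 = K.#-congʳ (quotient u∈D) (K.x#0y#0→xy#0 (denominator#0 u∈D)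
            (K.#-congʳ (Ψ-cong λ i → B.point-injective (d i) (T.trans (T.sym (u↦v i)) (y-point u∈D i))) Ψv#0))

    -- For s with f s outside Z take a chart d around f s and a polynomial q separating f s from Z
    -- there. The points whose image, if in d, is a zero of q form a closed set that contains the
    -- preimage of Z and misses s.
    preimage-isClosed : ∀ {f : S.Carrier → T.Carrier} → (∀ {s t} → s S.≈ t → f s T.≈ f t) →
                        IsRegular A B f → ∀ {Z} → IsClosed B Z → IsClosed A (λ s → f s ∈ Z)
    preimage-isClosed {f} f-cong f-regular {Z} Z-closed = supersets⇒closed A
      (λ s≈t → IsClosed.respects Z-closed (f-cong s≈t))
      λ {s} fs∉Z →
        let d , v , v↦fs = B.point-surjective (f s)
            q , qv#0 , q≈0 = closed⇒separated B Z-closed d v (fs∉Z ∘ IsClosed.respects Z-closed v↦fs)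
        in  _
          , zeros-isClosed {r = 1} (λ _ → f-cong) (λ _ → f-regular) (λ _ → d) (λ v → eval q (proj₁ (v zero)))
              (λ v≈w → eval-cong q (v≈w zero)) (λ c g y y-rat → rational-eval A q (y-rat zero))
          , (λ fs∈Z v s↦v → q≈0 (v zero) (IsClosed.respects Z-closed (s↦v zero) fs∈Z))
          , λ s∈ → K.#⇒≉ qv#0 (s∈ (λ _ → v) (λ _ → T.sym v↦fs))

-- Regular maps

module RegularMaps (em : ∀ {a} → ExcludedMiddle a) {ℓ : Level} (K : HeytingField ℓ ℓ ℓ) where

  private
    module K where
      open HeytingField K public hiding (zero)
      open Field em K public

  substitute : ∀ {m n} → (Fin m → Poly K n) → Poly K m → Poly K n
  substitute σ (con a) = con a
  substitute σ (var k) = σ k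
  substitute σ (p ⊕ q) = substitute σ p ⊕ substitute σ q
  substitute σ (p ⊗ q) = substitute σ p ⊗ substitute σ q

  eval-substitute : ∀ {m n} (σ : Fin m → Poly K n) p {x y} → (∀ k → eval (σ k) x K.≈ y k) →
                    eval (substitute σ p) x K.≈ eval p y
  eval-substitute σ (con a) σx≈y = K.refl
  eval-substitute σ (var k) σx≈y = σx≈y k
  eval-substitute σ (p ⊕ q) σx≈y = K.+-cong (eval-substitute σ p σx≈y) (eval-substitute σ q σx≈y)
  eval-substitute σ (p ⊗ q) σx≈y = K.*-cong (eval-substitute σ p σx≈y) (eval-substitute σ q σx≈y)

  -- Stronger than regularity: each chart is mapped into a single chart by polynomials. Projections
  -- and insertions of constants have this form, and composing a regular map with them amounts to
  -- substitution.
  IsPolynomial : ∀ {S T} → Atlas K S → Atlas K T → (Setoid.Carrier S → Setoid.Carrier T) → Set ℓ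
  IsPolynomial {T = T} A B f = ∀ c →
    Σ[ d ∈ B.Chart ] Σ[ σ ∈ (Fin (B.dim d) → Poly K (A.dim c)) ]
      (∀ (x : A.Coords c) → Σ[ y ∈ B.Coords d ] B.point d y ≈ f (A.point c x) ×
        (∀ k → eval (σ k) (proj₁ x) K.≈ proj₁ y k))
    where
    module A = Atlas A
    module B = Atlas B
    open Setoid T using (_≈_)

  regular-∘ : ∀ {S T U} (A : Atlas K S) (B : Atlas K T) (C : Atlas K U) f g →
              (∀ {s t} → Setoid._≈_ T s t → Setoid._≈_ U (g s) (g t)) →
              IsRegular B C g → IsPolynomial A B f → IsRegular A C (g ∘ f)
  regular-∘ {U = U} A B C f g g-cong g-regular f-polynomial c e u w gfu≈w =
    let d , σ , f-coords = f-polynomial c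
        v , v≈fu , σu≈v = f-coords u
        p , q , pv#0 , g-coords = g-regular d e v w (U.trans (g-cong v≈fu) gfu≈w)
    in  substitute σ p , (λ k → substitute σ (q k)) , K.#-congʳ (K.sym (eval-substitute σ p σu≈v)) pv#0
      , λ x px#0 →
          let y , y≈fx , σx≈y = f-coords x
              z , gy≈z , pz≈q = g-coords y (K.#-congʳ (eval-substitute σ p σx≈y) px#0)
          in  z , U.trans (U.sym (g-cong y≈fx)) gy≈z
            , λ k → K.trans (K.*-congʳ (eval-substitute σ p σx≈y))
                      (K.trans (pz≈q k) (K.sym (eval-substitute σ (q k) σx≈y)))
    where module U = Setoid U

  module _ {S T : Setoid ℓ ℓ} (A : Atlas K S) (B : Atlas K T) where

    private
      module S = Setoid S
      module T = Setoid T
      module A = Atlas A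
      module B = Atlas B
      module A×B = Atlas (A ×ᵃ B)

    left : ∀ {c d} → A×B.Coords (c , d) → A.Coords c
    left {c} {d} (x , x∈) =
      x ∘ (_↑ˡ B.dim d) , zeros-rename⁻ (A.equations c) (_↑ˡ B.dim d) (All.++⁻ˡ _ x∈)

    right : ∀ {c d} → A×B.Coords (c , d) → B.Coords d
    right {c} {d} (x , x∈) =
      x ∘ (A.dim c ↑ʳ_) , zeros-rename⁻ (B.equations d) (A.dim c ↑ʳ_)
                            (All.++⁻ʳ (map (rename (_↑ˡ B.dim d)) (A.equations c)) x∈)

    ++-↑ˡ : ∀ {m n} (x : Vector K.Carrier m) (y : Vector K.Carrier n) i → (x Vector.++ y) (i ↑ˡ n) ≡ x i
    ++-↑ˡ {m} {n} x y i rewrite splitAt-↑ˡ m i n = ≡.refl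

    ++-↑ʳ : ∀ {m n} (x : Vector K.Carrier m) (y : Vector K.Carrier n) j → (x Vector.++ y) (m ↑ʳ j) ≡ y j
    ++-↑ʳ {m} {n} x y j rewrite splitAt-↑ʳ m n j = ≡.refl

    pair : ∀ {c d} → A.Coords c → B.Coords d → A×B.Coords (c , d)
    pair {c} {d} (x , x∈) (y , y∈) = x Vector.++ y
      , All.++⁺ (zeros-rename⁺ (A.equations c) (_↑ˡ B.dim d) (++-↑ˡ x y) x∈)
                (zeros-rename⁺ (B.equations d) (A.dim c ↑ʳ_) (++-↑ʳ x y) y∈)

    point-pair : ∀ {c d} (u : A.Coords c) (v : B.Coords d) →
                 Setoid._≈_ (×-setoid S T) (A×B.point (c , d) (pair u v)) (A.point c u , B.point d v)
    point-pair {c} {d} u v =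
        A.point-cong c (λ i → K.reflexive (++-↑ˡ (proj₁ u) (proj₁ v) i))
      , B.point-cong d (λ j → K.reflexive (++-↑ʳ (proj₁ u) (proj₁ v) j))

    proj₁-polynomial : IsPolynomial (A ×ᵃ B) A proj₁
    proj₁-polynomial (c , d) = c , (λ i → var (i ↑ˡ B.dim d)) , λ x → left x , S.refl , λ _ → K.refl

    proj₂-polynomial : IsPolynomial (A ×ᵃ B) B proj₂
    proj₂-polynomial (c , d) = d , (λ j → var (A.dim c ↑ʳ j)) , λ x → right x , T.refl , λ _ → K.refl

    constˡ-polynomial : ∀ s → IsPolynomial B (A ×ᵃ B) (s ,_)
    constˡ-polynomial s d =
      let c , u , u≈s = A.point-surjective s
      in  (c , d) , (λ k → [ con ∘ proj₁ u , var ]′ (splitAt (A.dim c) k)) , λ y → pair u y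
        , (S.trans (proj₁ (point-pair u y)) u≈s , proj₂ (point-pair u y))
        , λ k → [con,var] (splitAt (A.dim c) k)
      where
      [con,var] : ∀ {m n} {x : Vector K.Carrier m} {y : Vector K.Carrier n} s →
                  eval ([ con ∘ x , var ]′ s) y K.≈ [ x , y ]′ s
      [con,var] (inj₁ _) = K.refl
      [con,var] (inj₂ _) = K.refl

    constʳ-polynomial : ∀ t → IsPolynomial A (A ×ᵃ B) (_, t)
    constʳ-polynomial t c =
      let d , v , v≈t = B.point-surjective t
      in  (c , d) , (λ k → [ var , con ∘ proj₁ v ]′ (splitAt (A.dim c) k)) , λ x → pair x v
        , (proj₁ (point-pair x v) , T.trans (proj₂ (point-pair x v)) v≈t)
        , λ k → [var,con] (splitAt (A.dim c) k)
      where
      [var,con] : ∀ {m n} {x : Vector K.Carrier m} {y : Vector K.Carrier n} s →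
                  eval ([ var , con ∘ y ]′ s) x K.≈ [ x , y ]′ s
      [var,con] (inj₁ _) = K.refl
      [var,con] (inj₂ _) = K.refl

  -- The product of the two denominators serves both components, each numerator being multiplied by
  -- the denominator of the other.
  regular-pair : ∀ {S T U} (A : Atlas K S) (B : Atlas K T) (C : Atlas K U) f g →
                 IsRegular A B f → IsRegular A C g → IsRegular A (B ×ᵃ C) (λ s → f s , g s)
  regular-pair {T = T} {U} A B C f g f-regular g-regular c (d , e) u v (fu≈v , gu≈w) =
    let p , q , pu#0 , f-coords = f-regular c d u (left B C v) fu≈v
        r , s , ru#0 , g-coords = g-regular c e u (right B C v) gu≈w
    in  p ⊗ r , (λ k → [ (λ i → q i ⊗ r) , (λ j → p ⊗ s j) ]′ (splitAt (Atlas.dim B d) k))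
      , K.x#0y#0→xy#0 pu#0 ru#0
      , λ x pr#0 →
          let y , fx≈y , py≈q = f-coords x (K.x*y#0⇒x#0 pr#0)
              z , gx≈z , rz≈s = g-coords x (K.x*y#0⇒y#0 pr#0)
          in  pair B C y z
            , ( Setoid.trans T fx≈y (Setoid.sym T (proj₁ (point-pair B C y z)))
              , Setoid.trans U gx≈z (Setoid.sym U (proj₂ (point-pair B C y z))))
            , λ k → quotients p r q s (proj₁ x) (proj₁ y) (proj₁ z) py≈q rz≈s (splitAt (Atlas.dim B d) k)
    where
    quotients : ∀ {l m n} (p r : Poly K n) (q : Vector (Poly K n) l) (s : Vector (Poly K n) m) x y z →
      (∀ i → eval p x K.* y i K.≈ eval (q i) x) → (∀ j → eval r x K.* z j K.≈ eval (s j) x) → ∀ k →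
      eval (p ⊗ r) x K.* [ y , z ]′ k K.≈ eval ([ (λ i → q i ⊗ r) , (λ j → p ⊗ s j) ]′ k) x
    quotients p r q s x y z py≈q rz≈s (inj₁ i) = K.trans
      (K.solve 3 (λ p r y → (p K.:* r) K.:* y K.:= (p K.:* y) K.:* r) K.refl (eval p x) (eval r x) (y i))
      (K.*-congʳ (py≈q i))
    quotients p r q s x y z py≈q rz≈s (inj₂ j) = K.trans (K.*-assoc _ _ _) (K.*-congˡ (rz≈s j))

  regular-map : ∀ {S S′ T T′} (A : Atlas K S) (A′ : Atlas K S′) (B : Atlas K T) (B′ : Atlas K T′) f f′ →
                (∀ {s t} → Setoid._≈_ S s t → Setoid._≈_ T (f s) (f t)) →
                (∀ {s t} → Setoid._≈_ S′ s t → Setoid._≈_ T′ (f′ s) (f′ t)) →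
                IsRegular A B f → IsRegular A′ B′ f′ →
                IsRegular (A ×ᵃ A′) (B ×ᵃ B′) (λ s → f (proj₁ s) , f′ (proj₂ s))
  regular-map A A′ B B′ f f′ f-cong f′-cong f-regular f′-regular = regular-pair (A ×ᵃ A′) B B′ (f ∘ proj₁) (f′ ∘ proj₂)
    (regular-∘ (A ×ᵃ A′) A B proj₁ f f-cong f-regular (proj₁-polynomial A A′))
    (regular-∘ (A ×ᵃ A′) A′ B′ proj₂ f′ f′-cong f′-regular (proj₂-polynomial A A′))

  onePoint-regular : ∀ {S} (A : Atlas K S) f → IsRegular A onePoint f
  onePoint-regular A f c d u v _ = con K.1# , (λ ()) , K.1#0 , λ _ _ → v , _ , λ ()

-- Powers of the group: translations and regrouping of factors

module Powers (em : ∀ {a} → ExcludedMiddle a) {ℓ : Level} {K : HeytingField ℓ ℓ ℓ}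
              (G : AlgebraicGroup K) where

  open RegularMaps em K
  open AlgebraicGroup G using (group; atlas; isVariety; ∙-regular; ⁻¹-regular)

  private
    module G = Group group
    module Pow n = Group (group ^ᵍ n)
    Gⁿ = λ n → Pow.Carrier n
    Gᵃ = powerAtlas G

  translationˡ-regular : ∀ n γ → IsRegular (Gᵃ n) (Gᵃ n) (Pow._∙_ n γ)
  translationˡ-regular zero    γ        = onePoint-regular onePoint _
  translationˡ-regular (suc n) (γ , γs) =
    regular-map atlas (Gᵃ n) atlas (Gᵃ n) (γ G.∙_) (Pow._∙_ n γs) G.∙-congˡ (Pow.∙-congˡ n)
      (regular-∘ atlas (atlas ×ᵃ atlas) atlas (γ ,_) (uncurry G._∙_) (uncurry G.∙-cong) ∙-regular
        (constˡ-polynomial atlas atlas γ))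
      (translationˡ-regular n γs)

  translationʳ-regular : ∀ n γ → IsRegular (Gᵃ n) (Gᵃ n) (λ s → Pow._∙_ n s γ)
  translationʳ-regular zero    γ        = onePoint-regular onePoint _
  translationʳ-regular (suc n) (γ , γs) =
    regular-map atlas (Gᵃ n) atlas (Gᵃ n) (G._∙ γ) (λ s → Pow._∙_ n s γs) G.∙-congʳ (Pow.∙-congʳ n)
      (regular-∘ atlas (atlas ×ᵃ atlas) atlas (_, γ) (uncurry G._∙_) (uncurry G.∙-cong) ∙-regular
        (constʳ-polynomial atlas atlas γ))
      (translationʳ-regular n γs)

  inverse-regular : ∀ n → IsRegular (Gᵃ n) (Gᵃ n) (Pow._⁻¹ n)
  inverse-regular zero    = onePoint-regular onePoint _
  inverse-regular (suc n) =
    regular-map atlas (Gᵃ n) atlas (Gᵃ n) G._⁻¹ (Pow._⁻¹ n) G.⁻¹-cong (Pow.⁻¹-cong n)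
      ⁻¹-regular (inverse-regular n)

  module _ (m : ℕ) where

    -- Powers are nested pairs, so the power of exponent n + m is not literally a product of two
    -- powers; `take`, `drop` and `glue` provide the identification.
    take : ∀ n → Gⁿ (n ℕ.+ m) → Gⁿ n
    take zero    _       = _
    take (suc n) (x , z) = x , take n z

    drop : ∀ n → Gⁿ (n ℕ.+ m) → Gⁿ m
    drop zero    z       = z
    drop (suc n) (_ , z) = drop n z

    glue : ∀ n → Gⁿ n → Gⁿ m → Gⁿ (n ℕ.+ m)
    glue zero    _       y = y
    glue (suc n) (x , z) y = x , glue n z y

    take-cong : ∀ n (x y : Gⁿ (n ℕ.+ m)) → Pow._≈_ (n ℕ.+ m) x y → Pow._≈_ n (take n x) (take n y)
    take-cong zero    _       _       _           = _
    take-cong (suc n) (_ , z) (_ , w) (x≈y , z≈w) = x≈y , take-cong n z w z≈w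

    drop-cong : ∀ n (x y : Gⁿ (n ℕ.+ m)) → Pow._≈_ (n ℕ.+ m) x y → Pow._≈_ m (drop n x) (drop n y)
    drop-cong zero    _       _       z≈w       = z≈w
    drop-cong (suc n) (_ , z) (_ , w) (_ , z≈w) = drop-cong n z w z≈w

    glue-cong : ∀ n (x x′ : Gⁿ n) (y y′ : Gⁿ m) → Pow._≈_ n x x′ → Pow._≈_ m y y′ →
                Pow._≈_ (n ℕ.+ m) (glue n x y) (glue n x′ y′)
    glue-cong zero    _       _        _ _  _             y≈y′ = y≈y′
    glue-cong (suc n) (_ , z) (_ , z′) y y′ (x≈x′ , z≈z′) y≈y′ = x≈x′ , glue-cong n z z′ y y′ z≈z′ y≈y′

    take-glue : ∀ n (x : Gⁿ n) (y : Gⁿ m) → take n (glue n x y) ≡ x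
    take-glue zero    _       y = ≡.refl
    take-glue (suc n) (x , z) y = ≡.cong (x ,_) (take-glue n z y)

    drop-glue : ∀ n (x : Gⁿ n) (y : Gⁿ m) → drop n (glue n x y) ≡ y
    drop-glue zero    _       y = ≡.refl
    drop-glue (suc n) (x , z) y = drop-glue n z y

    glue-∙ : ∀ n (x x′ : Gⁿ n) (y y′ : Gⁿ m) →
             glue n (Pow._∙_ n x x′) (Pow._∙_ m y y′) ≡ Pow._∙_ (n ℕ.+ m) (glue n x y) (glue n x′ y′)
    glue-∙ zero    _       _         y y′ = ≡.refl
    glue-∙ (suc n) (x , z) (x′ , z′) y y′ = ≡.cong (G._∙_ x x′ ,_) (glue-∙ n z z′ y y′)

    glue-ε : ∀ n → glue n (Pow.ε n) (Pow.ε m) ≡ Pow.ε (n ℕ.+ m)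
    glue-ε zero    = ≡.refl
    glue-ε (suc n) = ≡.cong (G.ε ,_) (glue-ε n)

    glue-⁻¹ : ∀ n (x : Gⁿ n) (y : Gⁿ m) →
              glue n (Pow._⁻¹ n x) (Pow._⁻¹ m y) ≡ Pow._⁻¹ (n ℕ.+ m) (glue n x y)
    glue-⁻¹ zero    _       y = ≡.refl
    glue-⁻¹ (suc n) (x , z) y = ≡.cong (G._⁻¹ x ,_) (glue-⁻¹ n z y)

    take-regular : ∀ n → IsRegular (Gᵃ (n ℕ.+ m)) (Gᵃ n) (take n)
    take-regular zero    = onePoint-regular (Gᵃ m) _
    take-regular (suc n) = regular-map atlas (Gᵃ (n ℕ.+ m)) atlas (Gᵃ n) id (take n)
      id (take-cong n _ _) (IsVariety.compatible isVariety) (take-regular n)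

    regular-∘-drop : ∀ n {T} (B : Atlas K T) (f : Gⁿ m → Setoid.Carrier T) →
                     (∀ {s t} → Pow._≈_ m s t → Setoid._≈_ T (f s) (f t)) →
                     IsRegular (Gᵃ m) B f → IsRegular (Gᵃ (n ℕ.+ m)) B (f ∘ drop n)
    regular-∘-drop zero    B f f-cong f-regular = f-regular
    regular-∘-drop (suc n) B f f-cong f-regular =
      regular-∘ (Gᵃ (suc n ℕ.+ m)) (Gᵃ (n ℕ.+ m)) B proj₂ (f ∘ drop n) (f-cong ∘ drop-cong n _ _)
        (regular-∘-drop n B f f-cong f-regular) (proj₂-polynomial atlas (Gᵃ (n ℕ.+ m)))

  module _ (n : ℕ) where

    -- Being of Lang type is a statement about powers of G only, so k-tuples of elements of Gⁿ are
    -- encoded in the power of exponent k n.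
    factor : ∀ {k} → Fin k → Gⁿ (k ℕ.* n) → Gⁿ n
    factor {suc k} zero    z = take (k ℕ.* n) n z
    factor {suc k} (suc i) z = factor i (drop (k ℕ.* n) n z)

    pack : ∀ {k} → (Fin k → Gⁿ n) → Gⁿ (k ℕ.* n)
    pack {zero}  xs = _
    pack {suc k} xs = glue (k ℕ.* n) n (xs zero) (pack (xs ∘ suc))

    factor-cong : ∀ {k} (i : Fin k) x y → Pow._≈_ (k ℕ.* n) x y → Pow._≈_ n (factor i x) (factor i y)
    factor-cong {suc k} zero    x y x≈y = take-cong (k ℕ.* n) n x y x≈y
    factor-cong {suc k} (suc i) x y x≈y = factor-cong i _ _ (drop-cong (k ℕ.* n) n x y x≈y)

    factor-pack : ∀ {k} (i : Fin k) xs → factor i (pack xs) ≡ xs i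
    factor-pack {suc k} zero    xs = take-glue (k ℕ.* n) n (xs zero) (pack (xs ∘ suc))
    factor-pack {suc k} (suc i) xs = ≡.trans
      (≡.cong (factor i) (drop-glue (k ℕ.* n) n (xs zero) (pack (xs ∘ suc)))) (factor-pack i (xs ∘ suc))

    factor-regular : ∀ {k} (i : Fin k) → IsRegular (Gᵃ (k ℕ.* n)) (Gᵃ n) (factor i)
    factor-regular {suc k} zero    = take-regular (k ℕ.* n) n
    factor-regular {suc k} (suc i) = regular-∘-drop (k ℕ.* n) n (Gᵃ n) (factor i) (factor-cong i _ _) (factor-regular i)

  module _ {Γ : Pred G.Carrier ℓ} where

    glue-power : ∀ m n {x : Gⁿ n} {y : Gⁿ m} → x ∈ power group Γ n → y ∈ power group Γ m →
                 glue m n x y ∈ power group Γ (n ℕ.+ m)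
    glue-power m zero    _         y∈ = y∈
    glue-power m (suc n) (x∈ , z∈) y∈ = x∈ , glue-power m n z∈ y∈

    take-power : ∀ m n {z : Gⁿ (n ℕ.+ m)} → z ∈ power group Γ (n ℕ.+ m) → take m n z ∈ power group Γ n
    take-power m zero    _         = _
    take-power m (suc n) (x∈ , z∈) = x∈ , take-power m n z∈

    pack-power : ∀ n {k} {xs : Fin k → Gⁿ n} → (∀ i → xs i ∈ power group Γ n) →
                 pack n xs ∈ power group Γ (k ℕ.* n)
    pack-power n {zero}  xs∈ = _
    pack-power n {suc k} xs∈ = glue-power (k ℕ.* n) n (xs∈ zero) (pack-power n (xs∈ ∘ suc))

-- Linear independence of functions

module LinearAlgebra (em : ∀ {a} → ExcludedMiddle a) {ℓ : Level} (K : HeytingField ℓ ℓ ℓ) where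

  open HeytingField K hiding (zero)
  open Field em K
  open SetoidReasoning setoid

  module _ {Y : Set ℓ} where

    -- The combination of f and g that vanishes at y, formed without dividing by f y.
    eliminate : (Y → Carrier) → Y → (Y → Carrier) → Y → Carrier
    eliminate f y g z = f y * g z + - 1# * (g y * f z)

    eliminate-vanishes : ∀ f y g → eliminate f y g y ≈ 0#
    eliminate-vanishes f y g = trans (+-congʳ (*-comm _ _)) (x+-1*x≈0 _)

    -- Fraction-free Gaussian elimination on the matrix fs i (ys j). The product
    -- of the pivots plays the part of the determinant.
    pivots : ∀ {k} → (Fin k → Y → Carrier) → (Fin k → Y) → Carrier
    pivots {zero}  fs ys = 1#
    pivots {suc k} fs ys =
      fs zero (ys zero) * pivots (eliminate (fs zero) (ys zero) ∘ fs ∘ suc) (ys ∘ suc)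

    pivots-cong : ∀ {k} {fs gs : Fin k → Y → Carrier} ys → (∀ i y → fs i y ≈ gs i y) →
                  pivots fs ys ≈ pivots gs ys
    pivots-cong {zero}  ys fs≈gs = refl
    pivots-cong {suc k} ys fs≈gs = *-cong (fs≈gs zero (ys zero)) (pivots-cong (ys ∘ suc) λ i z →
      +-cong (*-cong (fs≈gs zero (ys zero)) (fs≈gs (suc i) z))
             (*-congˡ (*-cong (fs≈gs (suc i) (ys zero)) (fs≈gs zero z))))

    -- Elimination combines the factors `c zero` and `c (suc i)` into their product, so the
    -- remaining rows are again scaled by nonzero constants.
    pivots-scale : ∀ {k} (fs : Fin k → Y → Carrier) ys {c : Fin k → Carrier} → (∀ i → c i # 0#) →
                   pivots fs ys # 0# → pivots (λ i y → c i * fs i y) ys # 0#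
    pivots-scale {zero}  fs ys c#0 p#0 = p#0
    pivots-scale {suc k} fs ys {c} c#0 p#0 = x#0y#0→xy#0 (x#0y#0→xy#0 (c#0 zero) (x*y#0⇒x#0 p#0))
      (#-congʳ
        (pivots-cong (ys ∘ suc) λ i z →
          solve 7 (λ a b f g f′ g′ n → (a :* b) :* (f :* g :+ n :* (g′ :* f′))
                                    := (a :* f) :* (b :* g) :+ n :* ((b :* g′) :* (a :* f′))) refl
            (c zero) (c (suc i)) (fs zero (ys zero)) (fs (suc i) z) (fs zero z) (fs (suc i) (ys zero)) (- 1#))
        (pivots-scale (eliminate (fs zero) (ys zero) ∘ fs ∘ suc) (ys ∘ suc)
          (λ i → x#0y#0→xy#0 (c#0 zero) (c#0 (suc i))) (x*y#0⇒y#0 p#0)))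

    -- As the `fs` vanish at y, elimination with the pivot g y only multiplies them by the nonzero
    -- constant g y.
    pivots-∷ : ∀ {k} (fs : Fin k → Y → Carrier) ys {g y} → g y # 0# → (∀ i → fs i y ≈ 0#) →
               pivots fs ys # 0# → pivots (g Vector.∷ fs) (y Vector.∷ ys) # 0#
    pivots-∷ fs ys {g} {y} gy#0 fsy≈0 p#0 = x#0y#0→xy#0 gy#0
      (#-congʳ
        (pivots-cong ys λ i z → sym (trans
          (+-congˡ (trans (*-congˡ (trans (*-congʳ (fsy≈0 i)) (zeroˡ _))) (zeroʳ _)))
          (+-identityʳ _)))
        (pivots-scale fs ys (λ _ → gy#0) p#0))

    -- Spans and the bound on the number of independent functions

    Span : List (Y → Carrier) → Pred (Y → Carrier) ℓ
    Span []       f = ∀ y → f y ≈ 0#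
    Span (b ∷ bs) f = ∃[ a ] ∃[ g ] g ∈ Span bs × (∀ y → f y ≈ a * b y + g y)

    span-respects : ∀ bs {f g} → (∀ y → f y ≈ g y) → f ∈ Span bs → g ∈ Span bs
    span-respects []       f≈g f≈0               = λ y → trans (sym (f≈g y)) (f≈0 y)
    span-respects (b ∷ bs) f≈g (a , h , h∈ , f≈) = a , h , h∈ , λ y → trans (sym (f≈g y)) (f≈ y)

    span-0 : ∀ bs → (λ _ → 0#) ∈ Span bs
    span-0 []       = λ _ → refl
    span-0 (b ∷ bs) = 0# , _ , span-0 bs , λ y → sym (trans (+-congʳ (zeroˡ _)) (+-identityʳ _))

    span-∷ : ∀ b bs {f} → f ∈ Span bs → f ∈ Span (b ∷ bs)
    span-∷ b bs f∈ = 0# , _ , f∈ , λ y → sym (trans (+-congʳ (zeroˡ _)) (+-identityˡ _))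

    span-+ : ∀ bs {f g} → f ∈ Span bs → g ∈ Span bs → (λ y → f y + g y) ∈ Span bs
    span-+ [] f≈0 g≈0 = λ y → trans (+-cong (f≈0 y) (g≈0 y)) (+-identityˡ 0#)
    span-+ (b ∷ bs) (a , f′ , f′∈ , f≈) (c , g′ , g′∈ , g≈) = a + c , _ , span-+ bs f′∈ g′∈ , λ y →
      trans (+-cong (f≈ y) (g≈ y))
        (solve 5 (λ a c b f g → (a :* b :+ f) :+ (c :* b :+ g) := (a :+ c) :* b :+ (f :+ g)) refl
          a c (b y) (f′ y) (g′ y))

    span-* : ∀ bs c {f} → f ∈ Span bs → (λ y → c * f y) ∈ Span bs
    span-* []       c f≈0                = λ y → trans (*-congˡ (f≈0 y)) (zeroʳ c)
    span-* (b ∷ bs) c (a , f′ , f′∈ , f≈) = c * a , _ , span-* bs c f′∈ , λ y →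
      trans (*-congˡ (f≈ y)) (trans (distribˡ _ _ _) (+-congʳ (sym (*-assoc _ _ _))))

    span-∈ : ∀ {bs b} → b List.∈ bs → b ∈ Span bs
    span-∈ {b ∷ bs} (here ≡.refl) = 1# , _ , span-0 bs , λ y → sym (trans (+-identityʳ _) (*-identityˡ _))
    span-∈ {b ∷ bs} (there b∈)    = span-∷ b bs (span-∈ b∈)

    span-⊆ : ∀ bs {cs} → (∀ {b} → b List.∈ bs → b List.∈ cs) → Span bs ⊆ Span cs
    span-⊆ []       {cs} bs⊆cs f≈0               = span-respects cs (sym ∘ f≈0) (span-0 cs)
    span-⊆ (b ∷ bs) {cs} bs⊆cs (a , g , g∈ , f≈) = span-respects cs (sym ∘ f≈)
      (span-+ cs (span-* cs a (span-∈ (bs⊆cs (here ≡.refl)))) (span-⊆ bs (bs⊆cs ∘ there) g∈))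

    span-eliminate : ∀ bs {f g} y → f ∈ Span bs → g ∈ Span bs → eliminate f y g ∈ Span bs
    span-eliminate bs {f} {g} y f∈ g∈ =
      span-+ bs (span-* bs (f y) g∈) (span-* bs (- 1#) (span-* bs (g y) f∈))

    -- `eliminate b y` is linear in its last argument.
    span-map-eliminate : ∀ b y bs {g} → g ∈ Span bs → eliminate b y g ∈ Span (map (eliminate b y) bs)
    span-map-eliminate b y [] {g} g≈0 z = begin
      b y * g z + - 1# * (g y * b z) ≈⟨ +-cong (*-congˡ (g≈0 z)) (*-congˡ (*-congʳ (g≈0 y))) ⟩
      b y * 0# + - 1# * (0# * b z)   ≈⟨ +-cong (zeroʳ _) (trans (*-congˡ (zeroˡ _)) (zeroʳ _)) ⟩
      0# + 0#                        ≈⟨ +-identityˡ 0# ⟩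
      0#                             ∎
    span-map-eliminate b y (c ∷ bs) {g} (a , h , h∈ , g≈) =
      a , _ , span-map-eliminate b y bs h∈ , λ z →
        trans (+-cong (*-congˡ (g≈ z)) (*-congˡ (*-congʳ (g≈ y))))
          (solve 8 (λ a b b′ c c′ h h′ n →
              b′ :* (a :* c :+ h) :+ n :* ((a :* c′ :+ h′) :* b)
              := a :* (b′ :* c :+ n :* (c′ :* b)) :+ (b′ :* h :+ n :* (h′ :* b))) refl
            a (b z) (b y) (c z) (c y) (h z) (h y) (- 1#))

    -- Evaluation at y is a nonzero functional on the span, so its kernel needs one generator fewer.
    -- The first generator not vanishing at y is dropped and eliminated from those after it; those
    -- before it are kept.
    span-vanishing : ∀ bs {f} y → f ∈ Span bs → f y # 0# →
                     ∃[ cs ] suc (length cs) ≡ length bs × (∀ {g} → g ∈ Span bs → g y ≈ 0# → g ∈ Span cs)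
    span-vanishing []       y f≈0 fy#0 = contradiction (f≈0 y) (#⇒≉ fy#0)
    span-vanishing (b ∷ bs) y (a , f′ , f′∈ , f≈) fy#0 with em {P = b y ≈ 0#}
    ... | no by≉0 =
      map (eliminate b y) bs , ≡.cong suc (length-map (eliminate b y) bs)
      -- From c b(y) + g′(y) = 0 it follows that b(y) g = `eliminate b y g′`; then b(y) is divided
      -- out.
      , λ {g} (c , g′ , g′∈ , g≈) gy≈0 →
          let i , i*by≈1 = inverse (≉⇒# by≉0)
          in  span-respects (map (eliminate b y) bs)
                (λ z → begin
                  i * (b y * g′ z + - 1# * (g′ y * b z)) ≈⟨ *-congˡ (begin
                    b y * g′ z + - 1# * (g′ y * b z) ≈⟨ +-identityʳ _ ⟨
                    (b y * g′ z + - 1# * (g′ y * b z)) + 0#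
                      ≈⟨ +-congˡ (trans (*-congʳ (trans (sym (g≈ y)) gy≈0)) (zeroˡ (b z))) ⟨
                    (b y * g′ z + - 1# * (g′ y * b z)) + (c * b y + g′ y) * b z
                      ≈⟨ solve 6 (λ b′ g g′ b c n → (b′ :* g :+ n :* (g′ :* b)) :+ (c :* b′ :+ g′) :* b
                                    := b′ :* (c :* b :+ g) :+ (g′ :* b :+ n :* (g′ :* b))) refl
                           (b y) (g′ z) (g′ y) (b z) c (- 1#) ⟩
                    b y * (c * b z + g′ z) + (g′ y * b z + - 1# * (g′ y * b z))
                      ≈⟨ +-cong (*-congˡ (sym (g≈ z))) (x+-1*x≈0 _) ⟩
                    b y * g z + 0# ≈⟨ +-identityʳ _ ⟩
                    b y * g z ∎) ⟩
                  i * (b y * g z) ≈⟨ *-assoc i (b y) (g z) ⟨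
                  i * b y * g z   ≈⟨ *-congʳ i*by≈1 ⟩
                  1# * g z        ≈⟨ *-identityˡ (g z) ⟩
                  g z             ∎)
                (span-* (map (eliminate b y) bs) i (span-map-eliminate b y bs g′∈))
    ... | yes by≈0 =
      let vanish : ∀ d h → (d * b y + h ≈ h)
          vanish d h = trans (+-congʳ (trans (*-congˡ by≈0) (zeroʳ d))) (+-identityˡ h)
          cs , |cs| , ⊆cs = span-vanishing bs y f′∈ (#-congʳ (trans (f≈ y) (vanish a (f′ y))) fy#0)
      in  b ∷ cs , ≡.cong suc |cs| , λ {g} (c , g′ , g′∈ , g≈) gy≈0 →
            c , g′ , ⊆cs g′∈ (trans (sym (trans (g≈ y) (vanish c (g′ y)))) gy≈0) , g≈

    -- After one elimination the remaining functions vanish at `ys zero`, so by `span-vanishing` a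
    -- list shorter by one spans them. The generators run out before the functions do, and some
    -- pivot is zero.
    pivots-bound : ∀ {k} bs {fs : Fin k → Y → Carrier} ys → length bs ℕ.< k →
                   (∀ i → fs i ∈ Span bs) → pivots fs ys ≈ 0#
    pivots-bound {suc k} bs {fs} ys |bs|<k fs∈ with em {P = fs zero (ys zero) ≈ 0#}
    ... | yes fy≈0 = trans (*-congʳ fy≈0) (zeroˡ _)
    ... | no  fy≉0 =
      let cs , |cs| , ⊆cs = span-vanishing bs (ys zero) (fs∈ zero) (≉⇒# fy≉0)
      in  trans (*-congˡ (pivots-bound cs (ys ∘ suc)
              (ℕ.≤-trans (ℕ.≤-reflexive |cs|) (ℕ.s≤s⁻¹ |bs|<k)) λ i →
              ⊆cs (span-eliminate bs (ys zero) (fs∈ zero) (fs∈ (suc i)))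
                  (eliminate-vanishes (fs zero) (ys zero) (fs (suc i)))))
            (zeroʳ _)

    span-map-* : ∀ (b : Y → Carrier) cs {g} → g ∈ Span cs → (λ y → b y * g y) ∈ Span (map (λ c y → b y * c y) cs)
    span-map-* b []       g≈0               = λ y → trans (*-congˡ (g≈0 y)) (zeroʳ _)
    span-map-* b (c ∷ cs) (a , h , h∈ , g≈) = a , _ , span-map-* b cs h∈ , λ y →
      trans (*-congˡ (g≈ y))
        (solve 4 (λ a b c h → b :* (a :* c :+ h) := a :* (b :* c) :+ b :* h) refl a (b y) (c y) (h y))

    products : List (Y → Carrier) → List (Y → Carrier) → List (Y → Carrier)
    products = cartesianProductWith (λ b c y → b y * c y)

    span-products : ∀ bs cs {f g} → f ∈ Span bs → g ∈ Span cs → (λ y → f y * g y) ∈ Span (products bs cs)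
    span-products []       cs f≈0 g∈ = λ y → trans (*-congʳ (f≈0 y)) (zeroˡ _)
    span-products (b ∷ bs) cs {f} {g} (a , f′ , f′∈ , f≈) g∈ =
      span-respects bcs
        (λ y → sym (trans (*-congʳ (f≈ y))
          (solve 4 (λ a b f g → (a :* b :+ f) :* g := a :* (b :* g) :+ f :* g) refl a (b y) (f′ y) (g y))))
        (span-+ bcs (span-* bcs a (span-⊆ (map (λ c y → b y * c y) cs) ∈-++⁺ˡ (span-map-* b cs g∈)))
                    (span-⊆ (products bs cs) (∈-++⁺ʳ (map (λ c y → b y * c y) cs)) (span-products bs cs f′∈ g∈)))
      where
      bcs = products (b ∷ bs) cs

  module _ (m : ℕ) {n : ℕ} where

    -- As x varies, p (x , y) runs through a finite dimensional space of functions of y.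
    basis : Poly K (m ℕ.+ n) → List (Vector Carrier n → Carrier)
    basis (con a) = (λ _ → 1#) ∷ []
    basis (var k) = [ (λ _ → (λ _ → 1#) ∷ []) , (λ j → (λ y → y j) ∷ []) ]′ (splitAt m k)
    basis (p ⊕ q) = basis p ++ basis q
    basis (p ⊗ q) = products (basis p) (basis q)

    span-1 : ∀ a → (λ _ → a) ∈ Span ((λ (_ : Vector Carrier n) → 1#) ∷ [])
    span-1 a = a , (λ _ → 0#) , (λ _ → refl) , λ _ → sym (trans (+-identityʳ _) (*-identityʳ a))

    span-basis : ∀ p (x : Vector Carrier m) → (λ (y : Vector Carrier n) → eval p (x Vector.++ y)) ∈ Span (basis p)
    span-basis (con a) x = span-1 a
    span-basis (var k) x with splitAt m k
    ... | inj₁ i = span-1 (x i)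
    ... | inj₂ j = span-∈ (here ≡.refl)
    span-basis (p ⊕ q) x = span-+ (basis p ++ basis q)
      (span-⊆ (basis p) ∈-++⁺ˡ (span-basis p x)) (span-⊆ (basis q) (∈-++⁺ʳ (basis p)) (span-basis q x))
    span-basis (p ⊗ q) x = span-products (basis p) (basis q) (span-basis p x) (span-basis q x)

  module _ {Y : Set ℓ} {S} (A : Atlas K S) {c : Atlas.Chart A} {g : Poly K (Atlas.dim A c)} where

    open Topology em K

    rational-pivots : ∀ {k} {fs : Domain A c g → Fin k → Y → Carrier} →
                      (∀ i y → IsRational A c g (λ x → fs x i y)) →
                      ∀ ys → IsRational A c g (λ x → pivots (fs x) ys)
    rational-pivots {zero}  fs-rational ys = rational-con A 1#
    rational-pivots {suc k} fs-rational ys = rational-* A (fs-rational zero (ys zero))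
      (rational-pivots
        (λ i z → rational-+ A (rational-* A (fs-rational zero (ys zero)) (fs-rational (suc i) z))
          (rational-* A (rational-con A (- 1#))
            (rational-* A (fs-rational (suc i) (ys zero)) (fs-rational zero z))))
        (ys ∘ suc))

-- Cosets and closed subgroups

module Coset {ℓ} (G : Group ℓ ℓ) {H : Pred (Group.Carrier G) ℓ} (isSubgroup : IsSubgroup G H) where

  open Group G
  open GroupProperties G using (⁻¹-anti-homo-∙; \\-leftDividesʳ; \\-leftDividesˡ)
  open IsSubgroup isSubgroup

  translate-respects : ∀ γ → translate G γ H Respects _≈_
  translate-respects γ x≈y (h , h∈ , x≈γh) = h , h∈ , trans (sym x≈y) x≈γh

  translate-∙ : ∀ {γ x h} → x ∈ translate G γ H → h ∈ H → x ∙ h ∈ translate G γ H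
  translate-∙ {γ} {x} {h} (h′ , h′∈ , x≈γh′) h∈ =
    h′ ∙ h , ∙-closed h′∈ h∈ , trans (∙-congʳ x≈γh′) (assoc γ h′ h)

  translate-⁻¹∙ : ∀ {γ x y} → x ∈ translate G γ H → y ∈ translate G γ H → x ⁻¹ ∙ y ∈ H
  translate-⁻¹∙ {γ} {x} {y} (h , h∈ , x≈γh) (k , k∈ , y≈γk) =
    respects (sym (trans (∙-cong (trans (⁻¹-cong x≈γh) (⁻¹-anti-homo-∙ γ h)) y≈γk)
                    (trans (assoc _ _ _) (∙-congˡ (\\-leftDividesʳ γ k)))))
             (∙-closed (⁻¹-closed h∈) k∈)

  ∈-translate : ∀ {γ x} → γ ⁻¹ ∙ x ∈ H → x ∈ translate G γ H
  ∈-translate {γ} {x} γ⁻¹x∈H = γ ⁻¹ ∙ x , γ⁻¹x∈H , sym (\\-leftDividesˡ γ x)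

  ∈-translate⁻ : ∀ {γ x} → x ∈ translate G γ H → γ ⁻¹ ∙ x ∈ H
  ∈-translate⁻ {γ} (h , h∈ , x≈γh) = respects (sym (trans (∙-congˡ x≈γh) (\\-leftDividesʳ γ h))) h∈

module ClosedSubgroups (em : ∀ {a} → ExcludedMiddle a) {ℓ : Level} {K : HeytingField ℓ ℓ ℓ}
                       (G : AlgebraicGroup K) (n : ℕ) where

  open AlgebraicGroup G using (group)
  open Group (group ^ᵍ n)
  open Topology em K
  open Powers em G

  private
    Gⁿ = powerAtlas G n

  left-closed : ∀ γ {Z} → IsClosed Gⁿ Z → IsClosed Gⁿ (λ x → γ ∙ x ∈ Z)
  left-closed γ = preimage-isClosed {A = Gⁿ} {B = Gⁿ} ∙-congˡ (translationˡ-regular n γ)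

  right-closed : ∀ γ {Z} → IsClosed Gⁿ Z → IsClosed Gⁿ (λ x → x ∙ γ ∈ Z)
  right-closed γ = preimage-isClosed {A = Gⁿ} {B = Gⁿ} ∙-congʳ (translationʳ-regular n γ)

  inverse-closed : ∀ {Z} → IsClosed Gⁿ Z → IsClosed Gⁿ (λ x → x ⁻¹ ∈ Z)
  inverse-closed = preimage-isClosed {A = Gⁿ} {B = Gⁿ} ⁻¹-cong (inverse-regular n)

  module _ {H : Pred Carrier ℓ} (isSubgroup : IsSubgroup (group ^ᵍ n) H) where

    open IsSubgroup isSubgroup

    private
      closed = cl-isClosed Gⁿ H

    cl-isSubgroup : IsSubgroup (group ^ᵍ n) (cl Gⁿ H)
    cl-isSubgroup = record
      { respects  = IsClosed.respects closed
      ; ε-closed  = ⊆cl Gⁿ ε-closed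
      -- One factor at a time: left translation by h in H maps the closure into itself, so right
      -- translation by y in the closure maps H, and hence its closure, into the closure.
      ; ∙-closed  = λ {x} {y} x∈ y∈ →
          cl-least Gⁿ (right-closed y closed) (λ {h} h∈ → cl-least Gⁿ (left-closed h closed)
            (λ h′∈ → ⊆cl Gⁿ (∙-closed h∈ h′∈)) y∈) x∈
      ; ⁻¹-closed = cl-least Gⁿ (inverse-closed closed) (⊆cl Gⁿ ∘ ⁻¹-closed)
      }

  translate-isClosed : ∀ γ {H} → IsSubgroup (group ^ᵍ n) H → IsClosed Gⁿ H →
                       IsClosed Gⁿ (translate (group ^ᵍ n) γ H)
  translate-isClosed γ {H} isSubgroup closed = supersets⇒closed Gⁿ
    (Coset.translate-respects (group ^ᵍ n) isSubgroup γ)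
    λ {s} s∉ → (λ x → γ ⁻¹ ∙ x ∈ H) , left-closed (γ ⁻¹) closed
      , Coset.∈-translate⁻ (group ^ᵍ n) isSubgroup , s∉ ∘ Coset.∈-translate (group ^ᵍ n) isSubgroup

-- Uniform families

module Uniformity (em : ∀ {a} → ExcludedMiddle a) {ℓ : Level} {K : HeytingField ℓ ℓ ℓ}
                  (G : AlgebraicGroup K) (Γ : Pred (AlgebraicGroup.Carrier G) ℓ) (n : ℕ)
                  {b} {Index : Set b} (S : Index → Pred (Group.Carrier (AlgebraicGroup.group G ^ᵍ n)) ℓ) where

  open AlgebraicGroup G using (group)

  private
    Gᵃ = powerAtlas G n
    Γⁿ = power group Γ n
    module Gⁿ = Group (group ^ᵍ n)

  Cosets : {J : Set} → (J → Pred Gⁿ.Carrier ℓ) → Pred J ℓ → (J → Gⁿ.Carrier) → Pred Gⁿ.Carrier ℓ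
  Cosets H I γ x = ∃[ i ] i ∈ I × x ∈ translate (group ^ᵍ n) (γ i) (H i)

  -- Relative to a set Q of indices, so that finitely many strata can be treated one by one. Here I
  -- is a predicate; excluded middle turns it into a `Subset` at the end.
  IsUniform : Pred Index ℓ → Set (lsuc ℓ ⊔ b)
  IsUniform Q =
    ∃[ m ] Σ[ H ∈ (Fin m → Pred Gⁿ.Carrier ℓ) ]
      (∀ i → IsSubgroup (group ^ᵍ n) (H i) × IsClosed Gᵃ (H i)) ×
      (∀ b → b ∈ Q → Σ[ I ∈ Pred (Fin m) ℓ ] Σ[ γ ∈ (Fin m → Gⁿ.Carrier) ]
        (∀ i → γ i ∈ Γⁿ) × closure Gᵃ (S b) ≐ Cosets H I γ)

  uniform-⊆ : ∀ {P Q} → P ⊆ Q → IsUniform Q → IsUniform P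
  uniform-⊆ P⊆Q (m , H , H-closed , cosets) = m , H , H-closed , λ b b∈P → cosets b (P⊆Q b∈P)

  module _ (ε∈Γⁿ : Gⁿ.ε ∈ Γⁿ) where

    -- The two lists of groups are concatenated. For a given index the groups of the other list are
    -- left out of I, and their representatives, which must still lie in Γⁿ, are set to ε.
    uniform-∪ : ∀ {P Q} → IsUniform P → IsUniform Q → IsUniform (λ b → b ∈ P ⊎ b ∈ Q)
    uniform-∪ {P} {Q} (m , H , H-closed , cosets) (m′ , H′ , H′-closed , cosets′) =
      m ℕ.+ m′ , [H,H′] ∘ splitAt m , closed ∘ splitAt m , λ b b∈ →
        let I , γ , γ∈ , cl⊆ , ⊆cl = cosets″ b b∈
        in  I ∘ splitAt m , γ ∘ splitAt m , γ∈ ∘ splitAt m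
          , (λ x∈ → let s , p = cl⊆ x∈ in
              join m m′ s
              , ≡.subst (λ s → s ∈ I × _ ∈ translate (group ^ᵍ n) (γ s) ([H,H′] s)) (≡.sym (splitAt-join m m′ s)) p)
          , λ (i , p) → ⊆cl (splitAt m i , p)
      where
      [H,H′] : Fin m ⊎ Fin m′ → Pred Gⁿ.Carrier ℓ
      [H,H′] = [ H , H′ ]′

      closed : ∀ s → IsSubgroup (group ^ᵍ n) ([H,H′] s) × IsClosed Gᵃ ([H,H′] s)
      closed (inj₁ i) = H-closed i
      closed (inj₂ i) = H′-closed i

      cosets″ : ∀ b → b ∈ P ⊎ b ∈ Q →
                Σ[ I ∈ Pred (Fin m ⊎ Fin m′) ℓ ] Σ[ γ ∈ (Fin m ⊎ Fin m′ → Gⁿ.Carrier) ]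
                  (∀ s → γ s ∈ Γⁿ) × closure Gᵃ (S b) ≐ Cosets [H,H′] I γ
      cosets″ b (inj₁ b∈P) =
        let I , γ , γ∈ , cl⊆ , ⊆cl = cosets b b∈P
        in  [ I , (λ _ → ⊥) ]′ , [ γ , (λ _ → Gⁿ.ε) ]′ , [ γ∈ , (λ _ → ε∈Γⁿ) ]
          , (λ x∈ → let i , p = cl⊆ x∈ in inj₁ i , p)
          , λ { (inj₁ i , p) → ⊆cl (i , p) }
      cosets″ b (inj₂ b∈Q) =
        let I , γ , γ∈ , cl⊆ , ⊆cl = cosets′ b b∈Q
        in  [ (λ _ → ⊥) , I ]′ , [ (λ _ → Gⁿ.ε) , γ ]′ , [ (λ _ → ε∈Γⁿ) , γ∈ ]
          , (λ x∈ → let i , p = cl⊆ x∈ in inj₂ i , p)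
          , λ { (inj₂ i , p) → ⊆cl (i , p) }

    uniform-Any : ∀ {A : Set} {Q : A → Pred Index ℓ} (as : List A) → (∀ a → IsUniform (Q a)) →
                  IsUniform (λ b → Any (λ a → b ∈ Q a) as)
    uniform-Any [] uniform = 0 , (λ ()) , (λ ()) , λ _ ()
    uniform-Any (a ∷ as) uniform =
      uniform-⊆ (λ { (here b∈) → inj₁ b∈ ; (there b∈) → inj₂ b∈ }) (uniform-∪ (uniform a) (uniform-Any as uniform))

  finite-subset : ∀ {m} (I : Pred (Fin m) ℓ) → Subset.Subset m
  finite-subset I = Vec.tabulate (λ i → does (em {P = I i}))

  ∈-finite-subset⁺ : ∀ {m} (I : Pred (Fin m) ℓ) {i} → i ∈ I → i Subset.∈ finite-subset I
  ∈-finite-subset⁺ I {i} i∈I =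
    lookup⇒[]= i _ (≡.trans (lookup∘tabulate _ i) (dec-true em i∈I))

  ∈-finite-subset⁻ : ∀ {m} (I : Pred (Fin m) ℓ) {i} → i Subset.∈ finite-subset I → i ∈ I
  ∈-finite-subset⁻ I {i} i∈
    with em {P = I i} | ≡.trans (≡.sym (lookup∘tabulate (λ i → does (em {P = I i})) i)) ([]=⇒lookup i∈)
  ... | yes i∈I | _ = i∈I

-- The stratification of a family by rank

module Family (em : ∀ {a} → ExcludedMiddle a) {ℓ : Level} {K : HeytingField ℓ ℓ ℓ}
              (G : AlgebraicGroup K) {Γ : Pred (AlgebraicGroup.Carrier G) ℓ}
              (Γ-isSubgroup : IsSubgroup (AlgebraicGroup.group G) Γ) (lang : IsOfLangType G Γ)
              (n : ℕ) (1≤n : 1 ℕ.≤ n) (B : Variety K)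
              {X : Pred (Group.Carrier (AlgebraicGroup.group G ^ᵍ n) × Variety.Point B) ℓ}
              (X-closed : IsClosed (powerAtlas G n ×ᵃ Variety.atlas B) X) where

  open AlgebraicGroup G using (group)
  open Topology em K
  open RegularMaps em K using (pair; point-pair)
  open LinearAlgebra em K
  open Powers em G
  open ClosedSubgroups em G n

  private
    module K where
      open HeytingField K public hiding (zero)
      open Field em K public
    module B where
      open Variety B public
      open Setoid points public using (_≈_; refl; sym; trans)
      open Atlas atlas public
    module X = IsClosed X-closed
    Gⁿ = powerAtlas G n
    module Gⁿ where
      open Group (group ^ᵍ n) public
      open Atlas Gⁿ public
    Γⁿ = power group Γ n

  power-respects : ∀ m → power group Γ m Respects Group._≈_ (group ^ᵍ m)
  power-respects zero    _           _         = _
  power-respects (suc m) (x≈y , z≈w) (x∈ , z∈) = IsSubgroup.respects Γ-isSubgroup x≈y x∈ , power-respects m z≈w z∈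

  power-ε : ∀ m → Group.ε (group ^ᵍ m) ∈ power group Γ m
  power-ε zero    = _
  power-ε (suc m) = IsSubgroup.ε-closed Γ-isSubgroup , power-ε m

  fibre : B.Point → Pred Gⁿ.Carrier ℓ
  fibre b = (λ x → (x , b) ∈ X) ∩ Γⁿ

  fibre-respects : ∀ b → fibre b Respects Gⁿ._≈_
  fibre-respects b x≈y (x∈X , x∈Γ) = X.respects (x≈y , B.refl) x∈X , power-respects n x≈y x∈Γ

  open Uniformity em G Γ n fibre

  -- Rows over a chart of B and their rank

  module _ (d : B.Chart) where

    equations : ∀ c → List (Poly K (Gⁿ.dim c ℕ.+ B.dim d))
    equations c = proj₁ (X.locally (c , d))

    -- Rows may come from different charts of Gⁿ, yet all are functions on the one affine space of
    -- the chart d, so their linear independence makes sense.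
    record Row : Set ℓ where
      constructor row
      field
        {chart}    : Gⁿ.Chart
        coords     : Gⁿ.Coords chart
        equation   : Poly K (Gⁿ.dim chart ℕ.+ B.dim d)
        ∈equations : equation List.∈ equations chart

      position : Gⁿ.Carrier
      position = Gⁿ.point chart coords

      function : Vector K.Carrier (B.dim d) → K.Carrier
      function y = eval equation (proj₁ coords Vector.++ y)

    open Row

    row-vanishes : ∀ r y → position r ∈ fibre (B.point d y) → function r (proj₁ y) K.≈ K.0#
    row-vanishes r y (x∈X , _) = All.lookup
      (Equivalence.to (proj₂ (X.locally (chart r , d)) (pair Gⁿ B.atlas (coords r) y))
        (X.respects (×-sym (point-pair Gⁿ B.atlas (coords r) y)) x∈X))
      (∈equations r)
      where
      ×-sym : ∀ {x x′ b b′} → x Gⁿ.≈ x′ × b B.≈ b′ → x′ Gⁿ.≈ x × b′ B.≈ b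
      ×-sym (x≈x′ , b≈b′) = Gⁿ.sym x≈x′ , B.sym b≈b′

    separating-row : ∀ {c} (u : Gⁿ.Coords c) y → ¬ (Gⁿ.point c u , B.point d y) ∈ X →
                     ∃[ p ] p List.∈ equations c × eval p (proj₁ u Vector.++ proj₁ y) K.# K.0#
    separating-row {c} u y u∉X =
      let p , p∈ , pu≉0 = find (All.¬All⇒Any¬ (λ _ → em) (equations c) λ uy∈ →
            u∉X (X.respects (point-pair Gⁿ B.atlas u y)
              (Equivalence.from (proj₂ (X.locally (c , d)) (pair Gⁿ B.atlas u y)) uy∈)))
      in  p , p∈ , K.≉⇒# pu≉0

    -- A nonzero product of pivots certifies linear independence. The test points `ys` range over
    -- the whole affine space of the chart, not only over B.
    Independent : ℕ → Pred (B.Coords d) ℓ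
    Independent k y = Σ[ rs ∈ (Fin k → Row) ] (∀ i → position (rs i) ∈ fibre (B.point d y)) ×
      ∃[ ys ] pivots (function ∘ rs) ys K.# K.0#

    HasRank : ℕ → Pred (B.Coords d) ℓ
    HasRank k y = y ∈ Independent k × y ∉ Independent (suc k)

    functions : List (Vector K.Carrier (B.dim d) → K.Carrier)
    functions = concat (map (λ c → concat (map (basis (Gⁿ.dim c)) (equations c))) Gⁿ.charts)

    row-∈-span : ∀ r → function r ∈ Span functions
    row-∈-span r = span-⊆ (basis (Gⁿ.dim (chart r)) (equation r))
      (λ b∈ → ∈-concat⁺′ (∈-concat⁺′ b∈ (∈-map⁺ (basis (Gⁿ.dim (chart r))) (∈equations r)))
                (∈-map⁺ (λ c → concat (map (basis (Gⁿ.dim c)) (equations c))) (Gⁿ.∈-charts (chart r))))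
      (span-basis (Gⁿ.dim (chart r)) (equation r) (proj₁ (coords r)))

    maxRank : ℕ
    maxRank = length functions

    -- Downward search from `suc maxRank`, where independence fails by `pivots-bound`. It stops at 0
    -- at the latest, because the empty product of pivots is 1. The bound does not depend on y.
    hasRank : ∀ y → ∃[ k ] k ℕ.< suc maxRank × y ∈ HasRank k
    hasRank y = go (suc maxRank) λ (rs , _ , ys , p#0) →
      K.#⇒≉ p#0 (pivots-bound functions ys ℕ.≤-refl (row-∈-span ∘ rs))
      where
      go : ∀ k → y ∉ Independent k → ∃[ j ] j ℕ.< k × y ∈ HasRank j
      go zero    y∉ = contradiction ((λ ()) , (λ ()) , (λ ()) , K.1#0) y∉
      go (suc k) y∉ with em {P = y ∈ Independent k}
      ... | yes y∈ = k , ℕ.n<1+n k , y∈ , y∉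
      ... | no  y∉′ = let j , j<k , y∈ = go k y∉′ in j , ℕ.m<n⇒m<1+n j<k , y∈

    -- The closed set of tuples attached to a rank

    module _ (k : ℕ) where

      private
        N = suc k ℕ.* n
        Gᴺ = powerAtlas G N
        module Gᴺ = Group (group ^ᵍ N)
        module Gᵏⁿ = Group (group ^ᵍ (k ℕ.* n))

      Tuples : Pred Gᴺ.Carrier ℓ
      Tuples z = ∃[ y ] y ∉ Independent (suc k) × (∀ (i : Fin (suc k)) → factor n i z ∈ fibre (B.point d y))

      W : Pred Gᴺ.Carrier ℓ
      W = cl Gᴺ Tuples

      _++ᵍ_ : Gⁿ.Carrier → Gᵏⁿ.Carrier → Gᴺ.Carrier
      _++ᵍ_ = glue (k ℕ.* n) n

      module _ (rs : Fin (suc k) → Row) (ys : Fin (suc k) → Vector K.Carrier (B.dim d)) where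

        -- Only the charts and equations of `rs` enter; the coordinates are those of the variable
        -- tuple.
        at : (∀ i → Gⁿ.Coords (chart (rs i))) → Fin (suc k) → Vector K.Carrier (B.dim d) → K.Carrier
        at v i y = eval (equation (rs i)) (proj₁ (v i) Vector.++ y)

        Dependent : Pred Gᴺ.Carrier ℓ
        Dependent z = ∀ v → (∀ i → factor n i z Gⁿ.≈ Gⁿ.point (chart (rs i)) (v i)) →
                      pivots (at v) ys K.≈ K.0#

        dependent-isClosed : IsClosed Gᴺ Dependent
        dependent-isClosed = zeros-isClosed {A = Gᴺ} {B = Gⁿ}
          (λ i → factor-cong n i _ _) (factor-regular n) (chart ∘ rs) (λ v → pivots (at v) ys)
          (λ v≈w → pivots-cong ys λ i y → eval-cong (equation (rs i)) λ j → ++-cong (v≈w i) y (splitAt _ j))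
          λ c g v v-rational → rational-pivots Gᴺ
            (λ i y → rational-eval Gᴺ (equation (rs i)) λ j → rational-++ (v-rational i) y (splitAt _ j)) ys
          where
          ++-cong : ∀ {m m′} {x x′ : Vector K.Carrier m} → (∀ i → x i K.≈ x′ i) → ∀ (y : Vector K.Carrier m′) s →
                    [ x , y ]′ s K.≈ [ x′ , y ]′ s
          ++-cong x≈x′ y (inj₁ i) = x≈x′ i
          ++-cong x≈x′ y (inj₂ j) = K.refl

          rational-++ : ∀ {c g m m′} {x : Domain Gᴺ c g → Vector K.Carrier m} →
                        (∀ i → IsRational Gᴺ c g (λ z → x z i)) → ∀ (y : Vector K.Carrier m′) s →
                        IsRational Gᴺ c g (λ z → [ x z , y ]′ s)
          rational-++ x-rational y (inj₁ i) = x-rational i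
          rational-++ x-rational y (inj₂ j) = rational-con Gᴺ (y j)

        -- A tuple in `Tuples` with a nonzero product of pivots would give k + 1 independent rows
        -- over one fibre, which the choice of y excludes. Since `Dependent` is closed, it contains
        -- the closure as well.
        W⊆Dependent : W ⊆ Dependent
        W⊆Dependent = cl-least Gᴺ dependent-isClosed λ (y , y∉ , z∈) v z≈v →
          decidable-stable em λ p≉0 → y∉
            ( (λ i → row (v i) (equation (rs i)) (∈equations (rs i)))
            , (λ i → fibre-respects (B.point d y) (z≈v i) (z∈ i))
            , ys , K.≉⇒# p≉0)

      module _ (y : B.Coords d) (rank : y ∈ HasRank k) where

        private
          rs = proj₁ (proj₁ rank)
          rs∈ = proj₁ (proj₂ (proj₁ rank))
          ys = proj₁ (proj₂ (proj₂ (proj₁ rank)))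
          pivots#0 = proj₂ (proj₂ (proj₂ (proj₁ rank)))

        parameters : Gᵏⁿ.Carrier
        parameters = pack n (position ∘ rs)

        parameters∈ : parameters ∈ power group Γ (k ℕ.* n)
        parameters∈ = pack-power n (proj₂ ∘ rs∈)

        fibre⇒W : ∀ {γ} → γ ∈ fibre (B.point d y) → γ ++ᵍ parameters ∈ W
        fibre⇒W {γ} γ∈ = ⊆cl Gᴺ (y , proj₂ rank , λ i →
          ≡.subst (_∈ fibre (B.point d y)) (≡.sym (factor-pack n i (γ Vector.∷ position ∘ rs))) (all i))
          where
          all : ∀ i → (γ Vector.∷ position ∘ rs) i ∈ fibre (B.point d y)
          all zero    = γ∈
          all (suc i) = rs∈ i

        W⇒fibre : ∀ {γ} → γ ∈ Γⁿ → γ ++ᵍ parameters ∈ W → γ ∈ fibre (B.point d y)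
        W⇒fibre {γ} γ∈Γ γ∈W = decidable-stable em λ γ∉ →
          let c , u , u≈γ = Gⁿ.point-surjective γ
              p , p∈ , py#0 = separating-row u y λ u∈X → γ∉ (X.respects (u≈γ , B.refl) u∈X , γ∈Γ)
              -- The new row goes in front with y itself as its test point: it is nonzero there,
              -- while the k old rows vanish.
              rs′ = row u p p∈ Vector.∷ rs
              p#0 = pivots-∷ (function ∘ rs) ys py#0 (λ i → row-vanishes (rs i) y (rs∈ i)) pivots#0
          in  K.#⇒≉ p#0 (W⊆Dependent rs′ (proj₁ y Vector.∷ ys) γ∈W (coords ∘ rs′) λ i →
                Gⁿ.trans (Gⁿ.reflexive (factor-pack n i (γ Vector.∷ position ∘ rs))) (agree (Gⁿ.sym u≈γ) i))
          where
          agree : ∀ {r} → γ Gⁿ.≈ position r → ∀ i →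
                  (γ Vector.∷ position ∘ rs) i Gⁿ.≈ position ((r Vector.∷ rs) i)
          agree γ≈r zero    = γ≈r
          agree γ≈r (suc i) = Gⁿ.refl

      -- Cosets in the fibres

      private
        langᴺ = lang N (ℕ.≤-trans 1≤n (ℕ.m≤m+n n (k ℕ.* n))) W (cl-isClosed Gᴺ Tuples)
        m = proj₁ langᴺ
        H = proj₁ (proj₂ langᴺ)
        γ = proj₁ (proj₂ (proj₂ langᴺ))
        H-isSubgroup = λ i → proj₁ (proj₁ (proj₂ (proj₂ (proj₂ langᴺ))) i)
        ⊆cosets = proj₁ (proj₂ (proj₂ (proj₂ (proj₂ langᴺ))))
        cosets⊆ = proj₂ (proj₂ (proj₂ (proj₂ (proj₂ langᴺ))))
        module Cosetᴺ i = Coset (group ^ᵍ N) (H-isSubgroup i)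

      A : Fin m → Pred Gⁿ.Carrier ℓ
      A i a = a ++ᵍ Gᵏⁿ.ε ∈ H i

      A-isSubgroup : ∀ i → IsSubgroup (group ^ᵍ n) (A i)
      A-isSubgroup i = record
        { respects  = λ x≈y → H.respects (glue-cong _ n _ _ _ _ x≈y Gᵏⁿ.refl)
        ; ε-closed  = ≡.subst (_∈ H i) (≡.sym (glue-ε _ n)) H.ε-closed
        ; ∙-closed  = λ {a} {b} a∈ b∈ → H.respects
            (Gᴺ.trans (Gᴺ.reflexive (≡.sym (glue-∙ _ n a b Gᵏⁿ.ε Gᵏⁿ.ε)))
                      (glue-cong _ n _ _ _ _ Gⁿ.refl (Gᵏⁿ.identityˡ _)))
            (H.∙-closed a∈ b∈)
        ; ⁻¹-closed = λ {a} a∈ → H.respects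
            (Gᴺ.trans (Gᴺ.reflexive (≡.sym (glue-⁻¹ _ n a Gᵏⁿ.ε)))
                      (glue-cong _ n _ _ _ _ Gⁿ.refl ε⁻¹≈ε))
            (H.⁻¹-closed a∈)
        }
        where
        module H = IsSubgroup (H-isSubgroup i)
        open GroupProperties (group ^ᵍ (k ℕ.* n)) using (ε⁻¹≈ε)

      module _ (y : B.Coords d) (rank : y ∈ HasRank k) where

        private
          π = parameters y rank

        -- The share of the i-th coset in the fibre. By `slice-∙` and `slice-⁻¹∙` it is empty or a
        -- coset of `A i`; only its position depends on y.
        Slice : Fin m → Pred Gⁿ.Carrier ℓ
        Slice i δ = δ ++ᵍ π ∈ translate (group ^ᵍ N) (γ i) (H i)

        slice∈Γⁿ : ∀ {i δ} → δ ∈ Slice i → δ ∈ Γⁿ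
        slice∈Γⁿ {i} {δ} δ∈ =
          ≡.subst (_∈ Γⁿ) (take-glue _ n δ π) (take-power _ n (proj₂ (cosets⊆ (i , δ∈))))

        slice⊆fibre : ∀ {i} → Slice i ⊆ fibre (B.point d y)
        slice⊆fibre {i} δ∈ = W⇒fibre y rank (slice∈Γⁿ δ∈) (proj₁ (cosets⊆ (i , δ∈)))

        fibre⊆slices : ∀ {δ} → δ ∈ fibre (B.point d y) → ∃[ i ] δ ∈ Slice i
        fibre⊆slices δ∈ = ⊆cosets (fibre⇒W y rank δ∈ , glue-power _ n (proj₂ δ∈) (parameters∈ y rank))

        slice-∙ : ∀ {i δ a} → δ ∈ Slice i → a ∈ A i → δ Gⁿ.∙ a ∈ Slice i
        slice-∙ {i} {δ} {a} δ∈ a∈ = Cosetᴺ.translate-respects i (γ i)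
          (Gᴺ.trans (Gᴺ.reflexive (≡.sym (glue-∙ _ n δ a π Gᵏⁿ.ε)))
                    (glue-cong _ n _ _ _ _ Gⁿ.refl (Gᵏⁿ.identityʳ π)))
          (Cosetᴺ.translate-∙ i δ∈ a∈)

        slice-⁻¹∙ : ∀ {i δ δ′} → δ ∈ Slice i → δ′ ∈ Slice i → δ Gⁿ.⁻¹ Gⁿ.∙ δ′ ∈ A i
        slice-⁻¹∙ {i} {δ} {δ′} δ∈ δ′∈ = IsSubgroup.respects (H-isSubgroup i)
          (Gᴺ.trans (Gᴺ.∙-congʳ (Gᴺ.reflexive (≡.sym (glue-⁻¹ _ n δ π))))
            (Gᴺ.trans (Gᴺ.reflexive (≡.sym (glue-∙ _ n (δ Gⁿ.⁻¹) δ′ (π Gᵏⁿ.⁻¹) π)))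
              (glue-cong _ n _ _ _ _ Gⁿ.refl (Gᵏⁿ.inverseˡ π))))
          (Cosetᴺ.translate-⁻¹∙ i δ∈ δ′∈)

        I : Pred (Fin m) ℓ
        I i = ∃[ δ ] δ ∈ Slice i

        -- An empty slice receives ε, because representatives have to lie in Γⁿ even for i outside
        -- I.
        representative : ∀ i → Σ[ δ ∈ Gⁿ.Carrier ] δ ∈ Γⁿ × (i ∈ I → δ ∈ Slice i)
        representative i = choose em
          where
          choose : Dec (i ∈ I) → Σ[ δ ∈ Gⁿ.Carrier ] δ ∈ Γⁿ × (i ∈ I → δ ∈ Slice i)
          choose (yes (δ , δ∈)) = δ , slice∈Γⁿ δ∈ , λ _ → δ∈
          choose (no i∉I)       = Gⁿ.ε , power-ε n , λ i∈I → contradiction i∈I i∉I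

        δ : Fin m → Gⁿ.Carrier
        δ i = proj₁ (representative i)

        δ∈ : ∀ {i} → i ∈ I → δ i ∈ Slice i
        δ∈ {i} = proj₂ (proj₂ (representative i))

        -- Empty for i outside I, so that the union can be taken over all of `Fin m`.
        cosets : Fin m → Pred Gⁿ.Carrier ℓ
        cosets i x = i ∈ I × x ∈ translate (group ^ᵍ n) (δ i) (cl Gⁿ (A i))

        cosets-isClosed : ∀ i → IsClosed Gⁿ (cosets i)
        cosets-isClosed i = supersets⇒closed Gⁿ
          (λ x≈y (i∈I , x∈) → i∈I , IsClosed.respects coset-isClosed x≈y x∈) (superset em)
          where
          coset-isClosed = translate-isClosed (δ i) (cl-isSubgroup (A-isSubgroup i)) (cl-isClosed Gⁿ (A i))

          superset : ∀ {x} → Dec (i ∈ I) → x ∉ cosets i → ∃[ Z ] IsClosed Gⁿ Z × cosets i ⊆ Z × x ∉ Z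
          superset (yes i∈I) x∉ = _ , coset-isClosed , proj₂ , λ x∈ → x∉ (i∈I , x∈)
          -- The union of no sets serves as the empty closed set.
          superset (no  i∉I) x∉ = _ , ⋃-isClosed Gⁿ {m = 0} {Z = λ ()} (λ ())
                        , (λ (i∈I , _) → contradiction i∈I i∉I) , λ ()

        -- The fibre is the union of its slices, which lie in finitely many closed translates.
        -- Conversely, if a closed Z contains the fibre, its preimage under translation by `δ i` is
        -- closed and contains `A i`, hence also the closure of `A i`.
        closure-fibre : closure Gⁿ (fibre (B.point d y)) ≐ Cosets (cl Gⁿ ∘ A) I δ
        closure-fibre = (λ x∈ → x∈ _ (⋃-isClosed Gⁿ cosets-isClosed) fibre⊆cosets) , cosets⊆closure
          where
          fibre⊆cosets : fibre (B.point d y) ⊆ (λ x → ∃[ i ] x ∈ cosets i)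
          fibre⊆cosets {x} x∈ =
            let i , x∈i = fibre⊆slices x∈
                i∈I = x , x∈i
            in  i , i∈I , Coset.∈-translate (group ^ᵍ n) (cl-isSubgroup (A-isSubgroup i))
                            (⊆cl Gⁿ (slice-⁻¹∙ (δ∈ i∈I) x∈i))

          cosets⊆closure : Cosets (cl Gⁿ ∘ A) I δ ⊆ closure Gⁿ (fibre (B.point d y))
          cosets⊆closure (i , i∈I , h , h∈ , x≈δh) Z Z-closed fibre⊆Z =
            IsClosed.respects Z-closed (Gⁿ.sym x≈δh)
              (cl-least Gⁿ (left-closed (δ i) Z-closed)
                (λ a∈ → fibre⊆Z (slice⊆fibre (slice-∙ (δ∈ i∈I) a∈))) h∈)

      -- Strata over different charts may overlap; it is enough that finitely many of them cover B.
      Stratum : Pred B.Point ℓ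
      Stratum b = ∃[ y ] B.point d y B.≈ b × y ∈ HasRank k

      stratum-uniform : IsUniform Stratum
      stratum-uniform = m , cl Gⁿ ∘ A
        , (λ i → cl-isSubgroup (A-isSubgroup i) , cl-isClosed Gⁿ (A i))
        , λ b (y , y≈b , rank) → I y rank , δ y rank , (λ i → proj₁ (proj₂ (representative y rank i)))
            , (λ x∈ → proj₁ (closure-fibre y rank) λ Z Z-closed ⊆Z → x∈ Z Z-closed (⊆Z ∘ move (B.sym y≈b)))
            , λ x∈ Z Z-closed ⊆Z → proj₂ (closure-fibre y rank) x∈ Z Z-closed (⊆Z ∘ move y≈b)
        where
        move : ∀ {b c} → b B.≈ c → fibre b ⊆ fibre c
        move b≈c (x∈X , x∈Γ) = X.respects (Gⁿ.refl , b≈c) x∈X , x∈Γ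

  uniform : IsUniform (λ _ → ⊤)
  uniform = uniform-⊆
    (λ {b} _ →
      let d , y , y≈b = B.point-surjective b
          k , k< , rank = hasRank d y
      in  lose (B.∈-charts d) (lose (∈-upTo⁺ k<) (y , y≈b , rank)))
    -- The list `upTo (suc (maxRank d))` consists of the ranks from 0 to `maxRank d` inclusive.
    (uniform-Any (power-ε n) B.charts λ d → uniform-Any (power-ε n) (upTo (suc (maxRank d))) (stratum-uniform d))

theorem1 : (∀ {a} → ExcludedMiddle a) →
    ∀ {ℓ} (K : HeytingField ℓ ℓ ℓ) → IsAlgebraicallyClosed K →
    (G : AlgebraicGroup K) (Γ : Pred (AlgebraicGroup.Carrier G) ℓ) →
    IsSubgroup (AlgebraicGroup.group G) Γ →
    IsOfLangType G Γ → IsUniformlyOfLangType G Γ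
theorem1 em K _ G Γ Γ-isSubgroup lang = lang , λ n 1≤n B X X-closed →
  let open Uniformity em G Γ n (Family.fibre em G Γ-isSubgroup lang n 1≤n B X-closed)
      m , H , H-closed , cosets = Family.uniform em G Γ-isSubgroup lang n 1≤n B X-closed
  in  m , H , H-closed , λ b →
        let I , γ , γ∈ , cl⊆ , ⊆cl = cosets b _
        in  finite-subset I , γ , γ∈
          , (λ x∈ → let i , i∈I , x∈i = cl⊆ x∈ in i , ∈-finite-subset⁺ I i∈I , x∈i)
          , λ (i , i∈I , x∈i) → ⊆cl (i , ∈-finite-subset⁻ I i∈I , x∈i)
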